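{- There is an algorithm $\mathcal{A}$ such that for any $w$-element tree $T$ and any $k\in[w]$, the $N$ many $k$-element subtrees of $T$ get enumerated by $\mathcal{A}$ in time $O(Nw^5)$.
   Context: $[w]=\{1,2,\dots,w\}$. A $w$-element tree is a (finite, undirected, unrooted) tree with $w$ vertices. Subtrees of $T$ are identified with their vertex sets: a $k$-element subtree is a $k$-element set of vertices of $T$ inducing a connected subgraph of $T$. To enumerate a collection of sets means to produce (list) all of them, one by one. The constant implied by $O(\cdot)$ is independent of $T$, $w$ and $k$. -}

module Defs where

open import Data.Bool.Base using (Bool; true; false; T; if_then_else_; _∧_)
open import Data.Fin.Base using (Fin)
open import Data.Fin.Subset using (Subset; ∣_∣) renaming (_∈_ to _∈ₛ_)
open import Data.List.Base
  using (List; []; _∷_; [_]; _++_; length; map; concatMap; drop; head; allFin;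
         cartesianProductWith)
open import Data.List.Membership.Propositional using (_∈_)
open import Data.List.Relation.Unary.Linked using (Linked)
open import Data.List.Relation.Unary.Unique.Propositional using (Unique)
open import Data.Maybe.Base using (fromMaybe)
open import Data.Nat.Base using (ℕ; suc; _≤_; _≡ᵇ_) renaming (_+_ to _+ℕ_; _∸_ to _∸ℕ_)
open import Data.Product.Base using (_×_)
open import Data.Vec.Base using (toList)
open import Function.Bundles using (_⇔_)
open import Relation.Binary.Construct.Closure.ReflexiveTransitive using (Star)
open import Relation.Binary.PropositionalEquality using (_≡_; _≢_)
open import Relation.Nullary.Negation.Core using (¬_)

------------------------------------------------------------------------
-- Graphs and trees

record Graph (n : ℕ) : Set where
  field
    adj         : Fin n → Fin n → Bool
    symmetric   : ∀ u v → adj u v ≡ adj v u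
    irreflexive : ∀ u → adj u u ≡ false

  Adj : Fin n → Fin n → Set
  Adj u v = T (adj u v)

open Graph public using (adj; Adj)

Connected : ∀ {n} → Graph n → Set
Connected G = ∀ u v → Star (Adj G) u v

-- The vertices v ∷ vs, in this order, form a cycle of length at least 3.
IsCycle : ∀ {n} → Graph n → Fin n → List (Fin n) → Set
IsCycle G v vs =
  Unique (v ∷ vs) × 2 ≤ length vs × Linked (Adj G) (v ∷ vs ++ [ v ])

Acyclic : ∀ {n} → Graph n → Set
Acyclic G = ∀ v vs → ¬ IsCycle G v vs

record Tree (n : ℕ) : Set where
  field
    graph     : Graph n
    connected : Connected graph
    acyclic   : Acyclic graph

open Tree public using (graph)

InducedAdj : ∀ {n} → Graph n → Subset n → Fin n → Fin n → Set
InducedAdj G S u v = u ∈ₛ S × v ∈ₛ S × Adj G u v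

InducesConnected : ∀ {n} → Graph n → Subset n → Set
InducesConnected G S = ∀ u v → u ∈ₛ S → v ∈ₛ S → Star (InducedAdj G S) u v

-- Meant for k ≥ 1: for k = 0 the empty set would qualify.
IsSubtree : ∀ {n} → Tree n → ℕ → Subset n → Set
IsSubtree T k S = ∣ S ∣ ≡ k × InducesConnected (graph T) S

record IsEnumeration {n} (T : Tree n) (k : ℕ) (Ss : List (Subset n)) : Set where
  field
    unique  : Unique Ss
    members : ∀ S → S ∈ Ss ⇔ IsSubtree T k S

------------------------------------------------------------------------
-- Algorithms: structured programs for a uniform-cost random access machine.
--
-- A program mentions only finitely many arrays, whose names are literals, so
-- interleaving them in a single memory costs a constant factor only.  Scalar
-- variables are cells 0 of arrays.  As in the Cook–Reckhow machine, the only
-- arithmetic is addition and (truncated) subtraction, since unit-cost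
-- multiplication of unbounded integers would be unreasonably powerful.

infixl 6 _+_ _∸_
infix  9 _[_]

data Exp : Set where
  lit     : ℕ → Exp
  _[_]    : (a : ℕ) (i : Exp) → Exp
  _+_ _∸_ : Exp → Exp → Exp

infix  4 _[_]≔_
infixr 3 _⨾_

data Program : Set where
  skip           : Program
  _[_]≔_         : (a : ℕ) (i e : Exp) → Program
  print          : Exp → Program
  _⨾_            : Program → Program → Program
  if_then_else′_ : Exp → Program → Program → Program
  while_loop_    : Exp → Program → Program

-- m a i is the content of cell i of array a.
Memory : Set
Memory = ℕ → ℕ → ℕ

write : Memory → ℕ → ℕ → ℕ → Memory
write m a i x b j = if (a ≡ᵇ b) ∧ (i ≡ᵇ j) then x else m b j

eval : Memory → Exp → ℕ
eval m (lit x)  = x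
eval m (a [ i ]) = m a (eval m i)
eval m (d + e)  = eval m d +ℕ eval m e
eval m (d ∸ e)  = eval m d ∸ℕ eval m e

cost : Exp → ℕ
cost (lit x)   = 1
cost (a [ i ]) = suc (cost i)
cost (d + e)   = suc (cost d +ℕ cost e)
cost (d ∸ e)   = suc (cost d +ℕ cost e)

-- p , m ⇓ m′ , o , t : started in memory m, the program p halts in memory m′
-- after t steps, having printed the sequence o.  A nonzero value is true.

infix 2 _,_⇓_,_,_

data _,_⇓_,_,_ : Program → Memory → Memory → List ℕ → ℕ → Set where

  skip : ∀ {m} → skip , m ⇓ m , [] , 1

  assign : ∀ {m a i e} →
    (a [ i ]≔ e) , m ⇓ write m a (eval m i) (eval m e) , [] , suc (cost i +ℕ cost e)

  print : ∀ {m e} → print e , m ⇓ m , [ eval m e ] , suc (cost e)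

  seq : ∀ {p q m m₁ m₂ o₁ o₂ t₁ t₂} →
    p , m ⇓ m₁ , o₁ , t₁ →
    q , m₁ ⇓ m₂ , o₂ , t₂ →
    (p ⨾ q) , m ⇓ m₂ , o₁ ++ o₂ , t₁ +ℕ t₂

  if-true : ∀ {e p q m m₁ o t} →
    eval m e ≢ 0 →
    p , m ⇓ m₁ , o , t →
    (if e then p else′ q) , m ⇓ m₁ , o , suc (cost e +ℕ t)

  if-false : ∀ {e p q m m₁ o t} →
    eval m e ≡ 0 →
    q , m ⇓ m₁ , o , t →
    (if e then p else′ q) , m ⇓ m₁ , o , suc (cost e +ℕ t)

  while-true : ∀ {e p m m₁ m₂ o₁ o₂ t₁ t₂} →
    eval m e ≢ 0 →
    p , m ⇓ m₁ , o₁ , t₁ →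
    (while e loop p) , m₁ ⇓ m₂ , o₂ , t₂ →
    (while e loop p) , m ⇓ m₂ , o₁ ++ o₂ , suc (cost e +ℕ (t₁ +ℕ t₂))

  while-false : ∀ {e p m} →
    eval m e ≡ 0 →
    (while e loop p) , m ⇓ m , [] , suc (cost e)

------------------------------------------------------------------------
-- Input and output conventions

bit : Bool → ℕ
bit false = 0
bit true  = 1

-- All cells beyond the given contents are 0.
load : List (List ℕ) → Memory
load xss a i = fromMaybe 0 (head (drop i (fromMaybe [] (head (drop a xss)))))

-- Array 0 holds the number of vertices, array 1 holds k, and array 2 holds the
-- adjacency matrix row by row.
input : ∀ {n} → Tree n → ℕ → Memory
input {n} T k = load
  ( [ n ]
  ∷ [ k ]
  ∷ cartesianProductWith (λ u v → bit (adj (graph T) u v)) (allFin n) (allFin n)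
  ∷ [])

-- Each set is printed as its characteristic vector, a block of n bits.
output : ∀ {n} → List (Subset n) → List ℕ
output = concatMap (λ S → map bit (toList S))

{-# OPTIONS --safe #-}

-- Depth-first search over pairs (I , O), asking for the k-element subtrees that contain I and
-- avoid O, where I is connected.  From I a set X is grown greedily by vertices outside O that are
-- adjacent to it (any such vertex if X is empty).  If X reaches k elements, it is itself a
-- solution; if it gets stuck earlier and I is nonempty, then every solution would lie inside X,
-- so there is none and (I , O) is dropped.  Otherwise the search splits on the first vertex v
-- added to X, into (I ∪ v , O) and (I , O ∪ v).  Hence every pair that is split while I is
-- nonempty has a solution below it, and O(N w) pairs are visited, at O(w³) steps each; the
-- connectedness of T gives N ≥ 1.
module Submission where

open import Defs
open import Data.List.Base using (length)
open import Data.Nat.Base using (ℕ; _≤_; _*_; _^_)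
open import Data.Product.Base using (Σ-syntax; ∃-syntax; _×_)
open import Data.Bool.Base using (Bool; true; false; if_then_else_) renaming (T to True)
open import Data.Bool.Properties using (T?)
open import Data.Empty using (⊥-elim)
open import Data.Fin.Base using (Fin; zero; suc; toℕ; fromℕ<)
open import Data.Fin.Properties using (any?; toℕ-fromℕ<; toℕ<n; toℕ-injective) renaming (_≟_ to _≟ᶠ_)
open import Data.Fin.Subset using (Subset; ∣_∣; ⊥; ⊤; _⊆_; inside; outside) renaming (_∈_ to _∈ₛ_; _∉_ to _∉ₛ_)
open import Data.Fin.Subset.Properties using (_∈?_; ∉⊥; ∣⊥∣≡0; ∈⊤; ∣⊤∣≡n; p⊆q⇒∣p∣≤∣q∣; drop-∷-⊆)
open import Data.List.Base using (List; []; _∷_; _++_; map; head; drop; tabulate; allFin; cartesianProductWith)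
open import Data.List.Membership.Propositional using (_∈_)
open import Data.List.Membership.Propositional.Properties using (∈-++⁺ˡ; ∈-++⁺ʳ; ∈-++⁻; ∈-length)
open import Data.List.Properties using (++-assoc; ++-identityʳ; concatMap-++; length-++; map-tabulate)
open import Data.List.Relation.Unary.All using ([])
open import Data.List.Relation.Unary.AllPairs using ([]; _∷_)
open import Data.List.Relation.Unary.Any using (here)
open import Data.List.Relation.Unary.Unique.Propositional using (Unique)
open import Data.List.Relation.Unary.Unique.Propositional.Properties using (++⁺)
open import Data.Maybe.Base using (fromMaybe)
open import Data.Nat.Base using (zero; suc; _<_; z≤n; s≤s; _≡ᵇ_; NonZero; >-nonZero; >-nonZero⁻¹) renaming (_+_ to _+ℕ_; _∸_ to _∸ℕ_)
open import Data.Nat.Properties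
open import Data.Nat.Tactic.RingSolver using (solve-∀)
open import Data.Product.Base using (∃; ∃₂; _,_; proj₁; proj₂)
open import Data.Sum.Base using (_⊎_; inj₁; inj₂; [_,_]′)
open import Data.Unit.Base using (tt)
open import Data.Vec.Base using ([]; _∷_; here; there; lookup; toList; updateAt)
open import Data.Vec.Properties using ([]≔-updates; []=⇒lookup; lookup⇒[]=; []≔-minimal; lookup∘update; lookup∘update′; lookup-replicate)
open import Function.Base using (_∘_)
open import Function.Bundles using (_⇔_; mk⇔; Equivalence)
open import Relation.Binary.Construct.Closure.ReflexiveTransitive using (Star; ε; _◅_; _◅◅_; gmap)
open import Relation.Binary.PropositionalEquality hiding ([_])
open import Relation.Nullary using (¬_; Dec; yes; no; contradiction)
open import Relation.Nullary.Decidable using (_×-dec_; _⊎-dec_; ¬?)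

-- A stuck X may be discarded only when I is nonempty. Every solution then shares a vertex with X,
-- so it lies in the component of T minus O that X has filled. For empty I the greedy set has filled
-- just one component, and a solution may sit in another. Such a pair is therefore split without any
-- witness. Only exclusions keep I empty, so these pairs form a single chain from the root, and the
-- chain is charged as if it were one additional solution.
--
-- Both children of a split have one undecided vertex less, so a solution lies below at most w
-- splits; this is the factor w in the number of visited pairs. A visit costs w³ because X grows at
-- most w times, each time after a scan of all w² ordered pairs of vertices. The total is of order N
-- w⁴, within the required bound.
--
-- The search needs no call stack: `(I , O ∪ v)` overwrites its parent in place and `(I ∪ v , O)` is
-- pushed above it. The price is a frame condition, namely that the work above a block leaves the
-- block intact.

private variable
  n : ℕ

-- Finite subsets

insert : Subset n → Fin n → Subset n
insert S v = updateAt S v (λ _ → inside)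

∈-insert : ∀ (S : Subset n) v → v ∈ₛ insert S v
∈-insert S v = []≔-updates S v

∈-insert⁺ : ∀ (S : Subset n) v {u} → u ∈ₛ S → u ∈ₛ insert S v
∈-insert⁺ S v {u} u∈S with u ≟ᶠ v
... | yes refl = ∈-insert S v
... | no u≢v   = []≔-minimal S u v u≢v u∈S

∈-insert⁻ : ∀ (S : Subset n) v {u} → u ∈ₛ insert S v → u ≡ v ⊎ u ∈ₛ S
∈-insert⁻ S v {u} u∈ with u ≟ᶠ v
... | yes u≡v = inj₁ u≡v
... | no u≢v  = inj₂ (lookup⇒[]= u S
  (trans (sym (lookup∘update′ u≢v S inside)) ([]=⇒lookup u∈)))

∣insert∣ : ∀ (S : Subset n) v → v ∉ₛ S → ∣ insert S v ∣ ≡ suc ∣ S ∣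
∣insert∣ (inside  ∷ S) zero    v∉S = contradiction here v∉S
∣insert∣ (outside ∷ S) zero    v∉S = refl
∣insert∣ (inside  ∷ S) (suc v) v∉S = cong suc (∣insert∣ S v (v∉S ∘ there))
∣insert∣ (outside ∷ S) (suc v) v∉S = ∣insert∣ S v (v∉S ∘ there)

∣p∣≡0⇒∉ : ∀ {p : Subset n} {x} → ∣ p ∣ ≡ 0 → x ∉ₛ p
∣p∣≡0⇒∉ {p = outside ∷ p} eq (there x∈p) = ∣p∣≡0⇒∉ eq x∈p

∣p∣>0⇒∃∈ : ∀ (p : Subset n) → 0 < ∣ p ∣ → ∃ (_∈ₛ p)
∣p∣>0⇒∃∈ (inside  ∷ p) 0<∣p∣ = zero , here
∣p∣>0⇒∃∈ (outside ∷ p) 0<∣p∣ with ∣p∣>0⇒∃∈ p 0<∣p∣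
... | x , x∈p = suc x , there x∈p

⊆∧∣∣≡⇒≡ : ∀ {p q : Subset n} → p ⊆ q → ∣ p ∣ ≡ ∣ q ∣ → p ≡ q
⊆∧∣∣≡⇒≡ {p = []}          {[]}          _   _  = refl
⊆∧∣∣≡⇒≡ {p = inside ∷ p}  {inside ∷ q}  p⊆q eq =
  cong (inside ∷_) (⊆∧∣∣≡⇒≡ (drop-∷-⊆ p⊆q) (suc-injective eq))
⊆∧∣∣≡⇒≡ {p = outside ∷ p} {outside ∷ q} p⊆q eq =
  cong (outside ∷_) (⊆∧∣∣≡⇒≡ (drop-∷-⊆ p⊆q) eq)
⊆∧∣∣≡⇒≡ {p = inside ∷ p}  {outside ∷ q} p⊆q _  = contradiction (p⊆q here) λ ()
⊆∧∣∣≡⇒≡ {p = outside ∷ p} {inside ∷ q}  p⊆q eq =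
  contradiction eq (<⇒≢ (s≤s (p⊆q⇒∣p∣≤∣q∣ (drop-∷-⊆ p⊆q))))

Disjoint : Subset n → Subset n → Set
Disjoint p q = ∀ {x} → x ∈ₛ p → x ∉ₛ q

disjoint⇒∣p∣+∣q∣≤n : ∀ (p q : Subset n) → Disjoint p q → ∣ p ∣ +ℕ ∣ q ∣ ≤ n
disjoint⇒∣p∣+∣q∣≤n []            []            _  = z≤n
disjoint⇒∣p∣+∣q∣≤n (inside ∷ p)  (inside ∷ q)  p∥q = contradiction here (p∥q here)
disjoint⇒∣p∣+∣q∣≤n (inside ∷ p)  (outside ∷ q) p∥q =
  s≤s (disjoint⇒∣p∣+∣q∣≤n p q (λ x∈p → p∥q (there x∈p) ∘ there))
disjoint⇒∣p∣+∣q∣≤n {suc n} (outside ∷ p) (inside ∷ q) p∥q =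
  subst (_≤ suc n) (sym (+-suc ∣ p ∣ ∣ q ∣))
    (s≤s (disjoint⇒∣p∣+∣q∣≤n p q (λ x∈p → p∥q (there x∈p) ∘ there)))
disjoint⇒∣p∣+∣q∣≤n (outside ∷ p) (outside ∷ q) p∥q =
  m≤n⇒m≤1+n (disjoint⇒∣p∣+∣q∣≤n p q (λ x∈p → p∥q (there x∈p) ∘ there))

-- Greedy growth of connected sets

module Growth (G : Graph n) where

  Extends : Subset n → Subset n → Fin n → Fin n → Set
  Extends X O u v = v ∉ₛ X × v ∉ₛ O × (∣ X ∣ ≡ 0 ⊎ u ∈ₛ X × Adj G u v)

  extends? : ∀ X O u v → Dec (Extends X O u v)
  extends? X O u v =
    ¬? (v ∈? X) ×-dec ¬? (v ∈? O) ×-dec ((∣ X ∣ ≟ 0) ⊎-dec ((u ∈? X) ×-dec T? (adj G u v)))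

  Closed : Subset n → Subset n → Set
  Closed X O = ∀ u v → ¬ Extends X O u v

  -- If `X` is nonempty, every path can be routed through the old neighbour `u` of the new vertex.
  insert-connected : ∀ {X O u v} → Extends X O u v →
    InducesConnected G X → InducesConnected G (insert X v)
  insert-connected {X} {O} {u} {v} (_ , _ , inj₁ X≡∅) _ a b a∈ b∈
    with ∈-insert⁻ X v a∈ | ∈-insert⁻ X v b∈
  ... | inj₁ refl | inj₁ refl = ε
  ... | inj₂ a∈X  | _         = contradiction a∈X (∣p∣≡0⇒∉ X≡∅)
  ... | _         | inj₂ b∈X  = contradiction b∈X (∣p∣≡0⇒∉ X≡∅)
  insert-connected {X} {O} {u} {v} (_ , _ , inj₂ (u∈X , uv)) conn a b a∈ b∈ =
    to (∈-insert⁻ X v a∈) ◅◅ from (∈-insert⁻ X v b∈)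
    where
    X⁺ = insert X v

    within : ∀ {x y} → x ∈ₛ X → y ∈ₛ X → Star (InducedAdj G X⁺) x y
    within x∈X y∈X = gmap (λ z → z)
      (λ (x∈ , y∈ , xy) → ∈-insert⁺ X v x∈ , ∈-insert⁺ X v y∈ , xy) (conn _ _ x∈X y∈X)

    to : ∀ {x} → x ≡ v ⊎ x ∈ₛ X → Star (InducedAdj G X⁺) x u
    to (inj₁ refl) = (∈-insert X v , ∈-insert⁺ X v u∈X ,
      subst True (Graph.symmetric G u v) uv) ◅ ε
    to (inj₂ x∈X)  = within x∈X u∈X

    from : ∀ {x} → x ≡ v ⊎ x ∈ₛ X → Star (InducedAdj G X⁺) u x
    from (inj₁ refl) = (∈-insert⁺ X v u∈X , ∈-insert X v , uv) ◅ ε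
    from (inj₂ x∈X)  = within u∈X x∈X

  -- A path inside `S` that starts in `X` cannot leave `X`: its first vertex outside `X` would be
  -- adjacent to `X` and, belonging to `S`, would avoid `O`, so it would extend `X`. An empty `X` is
  -- closed only if `O` contains every vertex.
  closed⇒⊇ : ∀ {X O S} → Closed X O → InducesConnected G S → Disjoint S O →
    (∣ X ∣ ≡ 0 ⊎ ∃ λ a → a ∈ₛ X × a ∈ₛ S) → S ⊆ X
  closed⇒⊇ {X} {O} {S} closed conn S∥O (inj₁ X≡∅) {s} s∈S with s ∈? X
  ... | yes s∈X = s∈X
  ... | no s∉X  = contradiction (s∉X , S∥O s∈S , inj₁ X≡∅) (closed s s)
  closed⇒⊇ {X} {O} {S} closed conn S∥O (inj₂ (a , a∈X , a∈S)) {s} s∈S =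
    follow a∈X (conn a s a∈S s∈S)
    where
    follow : ∀ {x} → x ∈ₛ X → Star (InducedAdj G S) x s → s ∈ₛ X
    follow x∈X ε = x∈X
    follow {x} x∈X (_◅_ {j = y} (_ , y∈S , xy) path) with y ∈? X
    ... | yes y∈X = follow y∈X path
    ... | no y∉X  = contradiction (y∉X , S∥O y∈S , inj₂ (x∈X , xy)) (closed x y)

  -- Supplies N ≥ 1. With nothing excluded, `closed⇒⊇` applied to the full vertex set shows that
  -- growth stops only when all `n` vertices have been absorbed, so every smaller size is passed on
  -- the way.
  connected-subset : Connected G → ∀ j → j ≤ n →
    Σ[ X ∈ Subset n ] (∣ X ∣ ≡ j × InducesConnected G X)
  connected-subset conn zero    _   =
    ⊥ , ∣⊥∣≡0 n , λ _ _ x∈⊥ → contradiction x∈⊥ ∉⊥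
  connected-subset conn (suc j) j<n with connected-subset conn j (<⇒≤ j<n)
  ... | X , ∣X∣≡j , Xconn with any? (λ u → any? (λ v → extends? X ⊥ u v))
  ...   | yes (u , v , ext@(v∉X , _)) =
          insert X v , trans (∣insert∣ X v v∉X) (cong suc ∣X∣≡j) , insert-connected {O = ⊥} ext Xconn
  ...   | no none = contradiction j<n (≤⇒≯ (subst₂ _≤_ (∣⊤∣≡n n) ∣X∣≡j
          (p⊆q⇒∣p∣≤∣q∣ (closed⇒⊇ {O = ⊥} {S = ⊤} (λ u v ext → none (u , v , ext))
            (λ u v _ _ → gmap (λ z → z) (λ uv → ∈⊤ , ∈⊤ , uv) (conn u v))
            (λ _ → ∉⊥) seed))))
    where
    seed : ∣ X ∣ ≡ 0 ⊎ ∃ λ a → a ∈ₛ X × a ∈ₛ ⊤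
    seed with ∣ X ∣ ≟ 0
    ... | yes eq = inj₁ eq
    ... | no neq with ∣p∣>0⇒∃∈ X (n≢0⇒n>0 neq)
    ...   | a , a∈X = inj₂ (a , a∈X , ∈⊤)

-- Solutions of a pair (I , O)

module Search (T : Tree n) (k : ℕ) where

  open Growth (graph T) public

  Compatible : Subset n → Subset n → Subset n → Set
  Compatible I O S = IsSubtree T k S × I ⊆ S × Disjoint S O

  insert-disjoint : ∀ {X O u v} → Extends X O u v → Disjoint X O → Disjoint (insert X v) O
  insert-disjoint {X} {v = v} (_ , v∉O , _) X∥O x∈ =
    [ (λ { refl → v∉O }) , X∥O ]′ (∈-insert⁻ X v x∈)

  record Enumerates (I O : Subset n) (Ss : List (Subset n)) : Set where
    field
      unique  : Unique Ss
      members : ∀ S → S ∈ Ss ⇔ Compatible I O S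
  open Enumerates

  enumerates-[] : ∀ {I O} → (∀ S → ¬ Compatible I O S) → Enumerates I O []
  enumerates-[] none .unique    = []
  enumerates-[] none .members S = mk⇔ (λ ()) (⊥-elim ∘ none S)

  enumerates-self : ∀ {I O} → Compatible I O I → Enumerates I O (I ∷ [])
  enumerates-self _ .unique = [] ∷ []
  enumerates-self {I} {O} c@((∣I∣≡k , _) , _) .members S = mk⇔
    (λ { (here refl) → c })
    (λ ((∣S∣≡k , _) , I⊆S , _) → here (sym (⊆∧∣∣≡⇒≡ I⊆S (trans ∣I∣≡k (sym ∣S∣≡k)))))

  -- The two lists share no set because `v` belongs to every member of the first and to no member of
  -- the second.
  enumerates-++ : ∀ {I O Ss Ss′} v →
    Enumerates (insert I v) O Ss → Enumerates I (insert O v) Ss′ → Enumerates I O (Ss ++ Ss′)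
  enumerates-++ {I} {O} {Ss} {Ss′} v with-v without-v = record
    { unique  = ++⁺ (unique with-v) (unique without-v) λ (S∈Ss , S∈Ss′) →
        proj₂ (proj₂ (to (members without-v _) S∈Ss′))
          (proj₁ (proj₂ (to (members with-v _) S∈Ss)) (∈-insert I v)) (∈-insert O v)
    ; members = λ S → mk⇔
        ([ weaken-in S ∘ to (members with-v S) , weaken-out S ∘ to (members without-v S) ]′
          ∘ ∈-++⁻ Ss)
        (split S)
    }
    where
    open Equivalence

    weaken-in : ∀ S → Compatible (insert I v) O S → Compatible I O S
    weaken-in S (sub , I⊆S , S∥O) = sub , I⊆S ∘ ∈-insert⁺ I v , S∥O

    weaken-out : ∀ S → Compatible I (insert O v) S → Compatible I O S
    weaken-out S (sub , I⊆S , S∥O) = sub , I⊆S , λ x∈S → S∥O x∈S ∘ ∈-insert⁺ O v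

    split : ∀ S → Compatible I O S → S ∈ Ss ++ Ss′
    split S (sub , I⊆S , S∥O) with v ∈? S
    ... | yes v∈S = ∈-++⁺ˡ (from (members with-v S) (sub ,
            (λ x∈ → [ (λ { refl → v∈S }) , I⊆S ]′ (∈-insert⁻ I v x∈)) , S∥O))
    ... | no v∉S  = ∈-++⁺ʳ Ss (from (members without-v S) (sub , I⊆S ,
            λ x∈S x∈ → [ (λ { refl → v∉S x∈S }) , S∥O x∈S ]′ (∈-insert⁻ O v x∈)))

  -- By `closed⇒⊇` a solution would fit inside `X`, which is too small. A nonempty `I` provides the
  -- common vertex of `X` and the solution that this argument starts from.
  closed⇒incompatible : ∀ {I O X} → Closed X O → I ⊆ X → (∣ X ∣ ≡ 0 ⊎ 0 < ∣ I ∣) → ∣ X ∣ < k →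
    ∀ S → ¬ Compatible I O S
  closed⇒incompatible {I} {O} {X} closed I⊆X seed ∣X∣<k S ((∣S∣≡k , conn) , I⊆S , S∥O) =
    <⇒≱ ∣X∣<k (subst (_≤ ∣ X ∣) ∣S∣≡k (p⊆q⇒∣p∣≤∣q∣ (closed⇒⊇ closed conn S∥O (common seed))))
    where
    common : ∣ X ∣ ≡ 0 ⊎ 0 < ∣ I ∣ → ∣ X ∣ ≡ 0 ⊎ ∃ λ a → a ∈ₛ X × a ∈ₛ S
    common (inj₁ X≡∅) = inj₁ X≡∅
    common (inj₂ I≢∅) with ∣p∣>0⇒∃∈ I I≢∅
    ... | a , a∈I = inj₂ (a , I⊆X a∈I , I⊆S a∈I)

-- Memory cells and loops

≡ᵇ-refl : ∀ i → (i ≡ᵇ i) ≡ true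
≡ᵇ-refl zero    = refl
≡ᵇ-refl (suc i) = ≡ᵇ-refl i

≢⇒≡ᵇ-false : ∀ {i j} → i ≢ j → (i ≡ᵇ j) ≡ false
≢⇒≡ᵇ-false {i} {j} i≢j with i ≡ᵇ j in eq
... | false = refl
... | true  = contradiction (≡ᵇ⇒≡ i j (subst True (sym eq) tt)) i≢j

write-same : ∀ m a i x → write m a i x a i ≡ x
write-same m a i x rewrite ≡ᵇ-refl a | ≡ᵇ-refl i = refl

var : ℕ → Exp
var a = a [ lit 0 ]

set : ℕ → Exp → Program
set a e = a [ lit 0 ]≔ e

for : ℕ → Program → Program
for a p = set a (lit 0) ⨾ while (var 0 ∸ var a) loop (p ⨾ set a (var a + lit 1))

-- Running times bounded by powers of n

module Timed (n : ℕ) .{{_ : NonZero n}} where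

  -- The bound has the shape c nʲ throughout, so that only the literals c have to be tracked.
  record Runs (p : Program) (m m′ : Memory) (o : List ℕ) (c j : ℕ) : Set where
    constructor within
    field
      {time}     : ℕ
      time≤      : time ≤ c * n ^ j
      derivation : p , m ⇓ m′ , o , time

  constant : ∀ c j → c ≤ c * n ^ j
  constant c j = m≤m*n c (n ^ j) {{m^n≢0 n j}}

  infixr 5 _⟫_
  _⟫_ : ∀ {p q m m₁ m₂ o₁ o₂ c₁ c₂ j} →
    Runs p m m₁ o₁ c₁ j → Runs q m₁ m₂ o₂ c₂ j → Runs (p ⨾ q) m m₂ (o₁ ++ o₂) (c₁ +ℕ c₂) j
  _⟫_ {c₁ = c₁} {c₂} {j} (within t₁≤ r₁) (within t₂≤ r₂) =
    within (≤-trans (+-mono-≤ t₁≤ t₂≤) (≤-reflexive (sym (*-distribʳ-+ (n ^ j) c₁ c₂)))) (seq r₁ r₂)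

  raise : ∀ {p m m′ o c i j} → i ≤ j → Runs p m m′ o c i → Runs p m m′ o c j
  raise {c = c} i≤j (within t≤ r) =
    within (≤-trans t≤ (*-monoʳ-≤ c (^-monoʳ-≤ n i≤j))) r

  relax : ∀ {p m m′ o c d j} → c ≤ d → Runs p m m′ o c j → Runs p m m′ o d j
  relax {j = j} c≤d (within t≤ r) = within (≤-trans t≤ (*-monoˡ-≤ (n ^ j) c≤d)) r

  skips : ∀ {m j} → Runs skip m m [] 1 j
  skips {j = j} = within (constant 1 j) skip

  assigns : ∀ {m a i e j} →
    Runs (a [ i ]≔ e) m (write m a (eval m i) (eval m e)) [] (suc (cost i +ℕ cost e)) j
  assigns {j = j} = within (constant _ j) assign

  prints : ∀ {m e j} → Runs (print e) m m (eval m e ∷ []) (suc (cost e)) j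
  prints {j = j} = within (constant _ j) print

  private
    charge : ∀ {t c d j} → t ≤ c * n ^ j → suc (d +ℕ t) ≤ (suc d +ℕ c) * n ^ j
    charge {t} {c} {d} {j} t≤ = begin
      suc d +ℕ t                  ≤⟨ +-mono-≤ (constant (suc d) j) t≤ ⟩
      suc d * n ^ j +ℕ c * n ^ j  ≡⟨ *-distribʳ-+ (n ^ j) (suc d) c ⟨
      (suc d +ℕ c) * n ^ j        ∎
      where open ≤-Reasoning

  if-yes : ∀ {e p q m m′ o c j} → eval m e ≢ 0 →
    Runs p m m′ o c j → Runs (if e then p else′ q) m m′ o (suc (cost e) +ℕ c) j
  if-yes {e} {j = j} e≢0 (within t≤ r) = within (charge {d = cost e} {j = j} t≤) (if-true e≢0 r)

  if-no : ∀ {e p q m m′ o c j} → eval m e ≡ 0 →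
    Runs q m m′ o c j → Runs (if e then p else′ q) m m′ o (suc (cost e) +ℕ c) j
  if-no {e} {j = j} e≡0 (within t≤ r) = within (charge {d = cost e} {j = j} t≤) (if-false e≡0 r)

  -- A loop rule with a variant: the index of `I` bounds the rounds still to come, and `rest d` is
  -- the output still due. Allowing any `d′ ≤ d` lets the variant fall to 0 at once, as happens when
  -- greedy growth gets stuck.
  module _ {e p c j} (I : ℕ → Memory → Set) (rest : ℕ → List ℕ)
    (rest-zero : rest 0 ≡ [])
    (exit : ∀ {m} → I 0 m → eval m e ≡ 0)
    (step : ∀ {d m} → I (suc d) m → eval m e ≢ 0 ×
      (∃ λ d′ → ∃₂ λ m′ o → d′ ≤ d × Runs p m m′ o c j × I d′ m′ × rest (suc d) ≡ o ++ rest d′))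
    where

    private
      round : ℕ
      round = (suc (cost e) +ℕ c) * n ^ j

      iterate : ∀ b {d m} → d ≤ b → I d m →
        ∃₂ λ m′ t → (while e loop p , m ⇓ m′ , rest d , t) × t ≤ suc b * round × I 0 m′
      iterate b {zero} {m} _ i = m , _ ,
        subst (λ o → while e loop p , m ⇓ m , o , suc (cost e)) (sym rest-zero) (while-false (exit i)) ,
        ≤-trans (≤-trans (m≤m+n _ c) (constant _ j)) (m≤m+n round (b * round)) , i
      iterate (suc b) {suc d} {m} (s≤s d≤b) i with step i
      ... | e≢0 , d′ , m′ , o , d′≤d , within {t} t≤ r , i′ , eq
        with iterate b (≤-trans d′≤d d≤b) i′
      ... | m″ , t′ , r′ , t′≤ , i″ = m″ , _ ,
        subst (λ o → while e loop p , m ⇓ m″ , o , _) (sym eq) (while-true e≢0 r r′) ,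
        (begin
          suc (cost e +ℕ (t +ℕ t′))   ≡⟨ cong suc (+-assoc (cost e) t t′) ⟨
          suc (cost e +ℕ t) +ℕ t′     ≤⟨ +-mono-≤ (charge {d = cost e} {j = j} t≤) t′≤ ⟩
          round +ℕ suc b * round      ∎) ,
        i″
        where open ≤-Reasoning

    while-runs : ∀ {d m} → d ≤ n → I d m →
      ∃ λ m′ → Runs (while e loop p) m m′ (rest d) (2 * (suc (cost e) +ℕ c)) (suc j) × I 0 m′
    while-runs d≤n i with iterate n d≤n i
    ... | m′ , t , r , t≤ , i′ = m′ , within (≤-trans t≤ bound) r , i′
      where
      open ≤-Reasoning
      rearrange : ∀ n c x → (n +ℕ n) * (c * x) ≡ 2 * c * (n * x)
      rearrange = solve-∀
      bound : suc n * round ≤ 2 * (suc (cost e) +ℕ c) * n ^ suc j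
      bound = begin
        -- The failing last test makes `n + 1` tests; since `n ≥ 1`, this is at most `2 n`.
        suc n * round                        ≤⟨ *-monoˡ-≤ round (+-monoˡ-≤ n (>-nonZero⁻¹ n)) ⟩
        (n +ℕ n) * round                     ≡⟨ rearrange n (suc (cost e) +ℕ c) (n ^ j) ⟩
        2 * (suc (cost e) +ℕ c) * n ^ suc j  ∎

  -- For an abstract array `a` a write to the counter does not reduce, so stability of `I` under
  -- such writes is a hypothesis, for every value `x`. At each use `a` is a literal that `I` does
  -- not mention, and stability holds by computation.
  for-runs : ∀ a {p c j} (I : ℕ → Memory → Set) (rest : ℕ → List ℕ) →
    rest n ≡ [] →
    (∀ {i m} → I i m → m 0 0 ≡ n) →
    (∀ {m} (i : Fin n) → m a 0 ≡ toℕ i → I (toℕ i) m →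
      ∃₂ λ m′ o → Runs p m m′ o c j × m′ a 0 ≡ toℕ i ×
        (∀ x → I (suc (toℕ i)) (write m′ a 0 x)) × rest (toℕ i) ≡ o ++ rest (suc (toℕ i))) →
    ∀ {m} → (∀ x → I 0 (write m a 0 x)) →
    ∃ λ m′ → Runs (for a p) m m′ (rest 0) (3 +ℕ 2 * (6 +ℕ (c +ℕ 6))) (suc j) × I n m′
  for-runs a {p} {c} {j} I rest rest-n size body {m₀} start =
    finish (while-runs {var 0 ∸ var a} {p ⨾ set a (var a + lit 1)} {c +ℕ 6} {j} At
      (λ d → rest (n ∸ℕ d)) rest-n exit step {n} {write m₀ a 0 0} ≤-refl
      (0 , refl , write-same m₀ a 0 0 , start 0))
    where
    At : ℕ → Memory → Set
    At d m = ∃ λ i → i +ℕ d ≡ n × m a 0 ≡ i × I i m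

    exit : ∀ {m} → At 0 m → eval m (var 0 ∸ var a) ≡ 0
    exit (i , eq , refl , inv) rewrite size inv | trans (sym (+-identityʳ i)) eq = n∸n≡0 n

    step : ∀ {d m} → At (suc d) m → eval m (var 0 ∸ var a) ≢ 0 ×
      (∃ λ d′ → ∃₂ λ m′ o → d′ ≤ d × Runs (p ⨾ set a (var a + lit 1)) m m′ o (c +ℕ 6) j × At d′ m′ ×
        rest (n ∸ℕ suc d) ≡ o ++ rest (n ∸ℕ d′))
    step {d} {m} (i , eq , mai , inv) = go (fromℕ< i<n) (toℕ-fromℕ< i<n)
      where
      i<n : i < n
      i<n = subst (i <_) eq (m<m+n i (s≤s z≤n))

      go : (v : Fin n) → toℕ v ≡ i → eval m (var 0 ∸ var a) ≢ 0 ×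
        (∃ λ d′ → ∃₂ λ m′ o → d′ ≤ d × Runs (p ⨾ set a (var a + lit 1)) m m′ o (c +ℕ 6) j × At d′ m′ ×
          rest (n ∸ℕ suc d) ≡ o ++ rest (n ∸ℕ d′))
      go v refl with body v mai inv
      ... | m′ , o , r , m′a , inv′ , out =
        subst₂ (λ x y → x ∸ℕ y ≢ 0) (sym (size inv)) (sym mai) (m>n⇒m∸n≢0 i<n) ,
        d , write m′ a 0 (m′ a 0 +ℕ 1) , o ++ [] , ≤-refl , (r ⟫ assigns {i = lit 0} {e = var a + lit 1}) ,
        (suc (toℕ v) , trans (sym (+-suc (toℕ v) d)) eq ,
          trans (write-same m′ a 0 (m′ a 0 +ℕ 1)) (trans (cong (_+ℕ 1) m′a) (+-comm (toℕ v) 1)) , inv′ (m′ a 0 +ℕ 1)) ,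
        (begin
          rest (n ∸ℕ suc d)          ≡⟨ cong (λ s → rest (s ∸ℕ suc d)) eq ⟨
          rest (toℕ v +ℕ suc d ∸ℕ suc d)  ≡⟨ cong rest (m+n∸n≡m (toℕ v) (suc d)) ⟩
          rest (toℕ v)               ≡⟨ out ⟩
          o ++ rest (suc (toℕ v))    ≡⟨ cong₂ _++_ (++-identityʳ o) (cong rest (m+n∸n≡m (suc (toℕ v)) d)) ⟨
          (o ++ []) ++ rest (suc (toℕ v) +ℕ d ∸ℕ d) ≡⟨ cong (λ s → (o ++ []) ++ rest (s ∸ℕ d)) (trans (sym (+-suc (toℕ v) d)) eq) ⟩
          (o ++ []) ++ rest (n ∸ℕ d) ∎)
        where open ≡-Reasoning

    finish : (∃ λ m′ → Runs (while (var 0 ∸ var a) loop (p ⨾ set a (var a + lit 1)))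
        (write m₀ a 0 0) m′ (rest (n ∸ℕ n)) (2 * (6 +ℕ (c +ℕ 6))) (suc j) × At 0 m′) →
      ∃ λ m′ → Runs (for a p) m₀ m′ (rest 0) (3 +ℕ 2 * (6 +ℕ (c +ℕ 6))) (suc j) × I n m′
    finish (m′ , r , (i , eq , _ , inv)) = m′ ,
      subst (λ o → Runs (for a p) m₀ m′ o (3 +ℕ 2 * (6 +ℕ (c +ℕ 6))) (suc j)) (cong rest (n∸n≡0 n))
        (assigns ⟫ r) ,
      subst (λ i → I i m′) (trans (sym (+-identityʳ i)) eq) inv

-- Arrays ins and outs hold a stack of blocks of n bits, which are the pairs (I , O); the cell of
-- cards at the start of a block holds ∣ I ∣.  The cell of top points past the topmost block and
-- that of base at its start; the bits of X are in cur and its size is in card.  The value n of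
-- found means that X grows no further.
order quota edges ins outs cur top base card cards pick found idx row col off : ℕ
order = 0
quota = 1
edges = 2
ins   = 3
outs  = 4
cur   = 5
top   = 6
base  = 7
card  = 8
cards = 9
pick  = 10
found = 11
idx   = 12
row   = 13
col   = 14
off   = 15

-- Each of the two ways in which col may extend cur contributes 1, and being blocked removes at
-- least 2.
guard : Exp
guard = (lit 1 ∸ var card) + ((cur [ var row ] + edges [ var off + var col ]) ∸ lit 1)
  ∸ (blocked + blocked)
  where
  blocked : Exp
  blocked = cur [ var col ] + outs [ var base + var col ]

-- The program

test scanRow find : Program
test = if guard then set found (var col) else′ skip
scanRow = for col test ⨾ set off (var order + var off)
find =
  set found (var order) ⨾
  set off (lit 0) ⨾
  for row scanRow

grow greedy : Program
grow =
  cur [ var found ]≔ lit 1 ⨾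
  set card (var card + lit 1) ⨾
  if (var quota ∸ var card) then find else′ set found (var order)
greedy = while (var order ∸ var found) loop grow

copyCell copy : Program
copyCell =
  cur [ var idx ]≔ ins [ var base + var idx ] ⨾
  ins [ var top + var idx ]≔ ins [ var base + var idx ] ⨾
  outs [ var top + var idx ]≔ outs [ var base + var idx ]
copy = for idx copyCell

branch : Program
branch =
  outs [ var base + var pick ]≔ lit 1 ⨾
  ins [ var top + var pick ]≔ lit 1 ⨾
  cards [ var top ]≔ cards [ var base ] + lit 1 ⨾
  set top (var top + var order)

extend : Program
extend =
  set pick (var found) ⨾
  greedy ⨾
  if (lit 1 ∸ cards [ var base ]) + (lit 1 ∸ (var quota ∸ var card))
    then branch
    else′ set top (var base)

expand : Program
expand =
  copy ⨾
  set card (cards [ var base ]) ⨾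
  find ⨾
  if (var order ∸ var found) then extend else′ set top (var base)

printCell body : Program
printCell = print (ins [ var base + var idx ])
body =
  set base (var top ∸ var order) ⨾
  if (var quota ∸ cards [ var base ])
    then expand
    else′ (for idx printCell ⨾ set top (var base))

mainLoop : Program
mainLoop = while (var top) loop body

-- Step costs

forCost : ℕ → ℕ
forCost c = 3 +ℕ 2 * (6 +ℕ (c +ℕ 6))

-- The summands follow the commands in order. A conditional is charged its test and the dearer
-- branch, except in `bodyCost`, which adds up both branches.
testCost scanRowCost findCost growCost greedyCost cellCost copyCost branchCost extendCost expandCost bodyCost : ℕ
testCost = suc (cost guard) +ℕ 4
scanRowCost = forCost testCost +ℕ 7
findCost = 4 +ℕ (3 +ℕ forCost scanRowCost)
growCost = 4 +ℕ (6 +ℕ (6 +ℕ findCost))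
greedyCost = 2 * (6 +ℕ growCost)
cellCost = 9 +ℕ (12 +ℕ 12)
copyCost = forCost cellCost
branchCost = 7 +ℕ (7 +ℕ (8 +ℕ 7))
extendCost = 4 +ℕ (greedyCost +ℕ (14 +ℕ branchCost))
expandCost = copyCost +ℕ (5 +ℕ (findCost +ℕ (6 +ℕ extendCost)))
bodyCost = 7 +ℕ (7 +ℕ (expandCost +ℕ (forCost 7 +ℕ 4)))

-- The arithmetic guard

guardValue : ℕ → Bool → Bool → Bool → Bool → ℕ
guardValue c x e y o =
  (1 ∸ℕ c) +ℕ ((bit x +ℕ bit e) ∸ℕ 1) ∸ℕ ((bit y +ℕ bit o) +ℕ (bit y +ℕ bit o))

Open : ℕ → Bool → Bool → Bool → Bool → Set
Open c x e y o = y ≡ false × o ≡ false × (c ≡ 0 ⊎ x ≡ true × e ≡ true)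

enabled≤2 : ∀ c x e → (1 ∸ℕ c) +ℕ ((bit x +ℕ bit e) ∸ℕ 1) ≤ 2
enabled≤2 c true  true  = +-mono-≤ (m∸n≤m 1 c) ≤-refl
enabled≤2 c true  false = +-mono-≤ (m∸n≤m 1 c) z≤n
enabled≤2 c false true  = +-mono-≤ (m∸n≤m 1 c) z≤n
enabled≤2 c false false = +-mono-≤ (m∸n≤m 1 c) z≤n

guard-correct : ∀ c x e y o →
  guardValue c x e y o ≢ 0 × Open c x e y o ⊎ guardValue c x e y o ≡ 0 × ¬ Open c x e y o
guard-correct zero    x     e     false false = inj₁ ((λ ()) , refl , refl , inj₁ refl)
guard-correct (suc c) true  true  false false rewrite 0∸n≡0 c =
  inj₁ ((λ ()) , refl , refl , inj₂ (refl , refl))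
guard-correct (suc c) true  false false false rewrite 0∸n≡0 c =
  inj₂ (refl , λ { (_ , _ , inj₂ (_ , ())) })
guard-correct (suc c) false true  false false rewrite 0∸n≡0 c =
  inj₂ (refl , λ { (_ , _ , inj₂ (() , _)) })
guard-correct (suc c) false false false false rewrite 0∸n≡0 c =
  inj₂ (refl , λ { (_ , _ , inj₂ (() , _)) })
guard-correct c x e y o@true =
  inj₂ (m≤n⇒m∸n≡0 (≤-trans (enabled≤2 c x e) (+-mono-≤ (m≤n+m 1 (bit y)) (m≤n+m 1 (bit y)))) , λ { (_ , () , _) })
guard-correct c x e y@true o@false =
  inj₂ (m≤n⇒m∸n≡0 (enabled≤2 c x e) , λ { (() , _) })

put : (ℕ → ℕ) → ℕ → ℕ → ℕ → ℕ
put g i x j = if i ≡ᵇ j then x else g j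

put-hit : ∀ g {i j} x → i ≡ j → put g i x j ≡ x
put-hit g {i} x refl rewrite ≡ᵇ-refl i = refl

put-miss : ∀ g {i j} x → i ≢ j → put g i x j ≡ g j
put-miss g x i≢j rewrite ≢⇒≡ᵇ-false i≢j = refl

-- Correctness of the program

module Correctness {n : ℕ} .{{_ : NonZero n}} (T : Tree n) (k : ℕ) (k≤n : k ≤ n) where

  open Timed n
  open Search T k

  Block : (ℕ → ℕ) → ℕ → Subset n → Set
  Block g b S = ∀ i → g (b +ℕ toℕ i) ≡ bit (lookup S i)

  BlockUpTo : ℕ → (ℕ → ℕ) → ℕ → Subset n → Set
  BlockUpTo j g b S = ∀ i → toℕ i < j → g (b +ℕ toℕ i) ≡ bit (lookup S i)

  block-put-miss : ∀ g b S {i x} → b +ℕ n ≤ i → Block g b S → Block (put g i x) b S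
  block-put-miss g b S {x = x} b+n≤i block v =
    trans (put-miss g x (>⇒≢ (<-≤-trans (+-monoʳ-< b (toℕ<n v)) b+n≤i))) (block v)

  block-put-low : ∀ g b S {i x} → i < b → Block g b S → Block (put g i x) b S
  block-put-low g b S {x = x} i<b block v =
    trans (put-miss g x (<⇒≢ (<-≤-trans i<b (m≤m+n b (toℕ v))))) (block v)

  block-insert : ∀ g b S {i} v → i ≡ b +ℕ toℕ v → Block g b S → Block (put g i 1) b (insert S v)
  block-insert g b S v refl block u with toℕ v ≟ toℕ u
  ... | yes eq rewrite sym (toℕ-injective eq) =
        trans (put-hit g 1 refl) (cong bit (sym (lookup∘update v S true)))
  ... | no neq =
        trans (put-miss g 1 (neq ∘ +-cancelˡ-≡ b _ _))
          (trans (block u) (cong bit (sym (lookup∘update′ (neq ∘ cong toℕ ∘ sym) S true))))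

  blockUpTo-put : ∀ g b S {i x} v → i ≡ b +ℕ toℕ v → x ≡ bit (lookup S v) →
    BlockUpTo (toℕ v) g b S → BlockUpTo (suc (toℕ v)) (put g i x) b S
  blockUpTo-put g b S {x = x} v refl refl block u u≤v with m<1+n⇒m<n∨m≡n u≤v
  ... | inj₁ u<v = trans (put-miss g x (>⇒≢ u<v ∘ +-cancelˡ-≡ b _ _)) (block u u<v)
  ... | inj₂ u≡v rewrite toℕ-injective u≡v = put-hit g x refl

  -- The predicates on memories are products that compute, so that a write to an array they do
  -- not mention preserves them definitionally.
  Sizes : Memory → Set
  Sizes m = m order 0 ≡ n × m quota 0 ≡ k ×
    (∀ u v → m edges (toℕ u * n +ℕ toℕ v) ≡ bit (adj (graph T) u v))

  -- The frame condition: the stack below `b` is untouched, so a pair survives the search of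
  -- everything stacked above it.
  Below : ℕ → Memory → Memory → Set
  Below b m m′ = ∀ i → i < b → m′ ins i ≡ m ins i × m′ outs i ≡ m outs i × m′ cards i ≡ m cards i

  State : ℕ → Subset n → Subset n → Memory → Set
  State b I O m = Sizes m × m top 0 ≡ b +ℕ n × m cards b ≡ ∣ I ∣ × Block (m ins) b I × Block (m outs) b O

  record Valid (I O : Subset n) : Set where
    field
      linked   : InducesConnected (graph T) I
      disjoint : Disjoint I O
      small    : ∣ I ∣ ≤ k

  -- One round of the main loop

  module Step (b : ℕ) (I O : Subset n) (m₀ : Memory) where

    c : ℕ
    c = b +ℕ n

    Based : Memory → Set
    Based m = State b I O m × m base 0 ≡ b × Below b m₀ m

    -- The pair is stored twice, at `b` and at `c`: it is copied before it is known whether it will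
    -- be split, and splitting then sets one bit in each copy, a bit of `outs` at `b` and a bit of
    -- `ins` at `c`.
    Inv : Subset n → ℕ → Memory → Set
    Inv X p m = Based m × Block (m ins) c I × Block (m outs) c O ×
      m pick 0 ≡ p × m card 0 ≡ ∣ X ∣ × Block (m cur) 0 X

    module _ (X : Subset n) where

      -- `Scanned` qualifies only the failure. A hit does not end the scan and may be overwritten by
      -- a later one, so any extension is acceptable as witness.
      Found : (Fin n → Fin n → Set) → Memory → Set
      Found Scanned m =
        (∃₂ λ u v → m found 0 ≡ toℕ v × Extends X O u v)
        ⊎ m found 0 ≡ n × (∀ u v → Scanned u v → ¬ Extends X O u v)

      guard-eval : ∀ {p m} u v → Inv X p m → m off 0 ≡ toℕ u * n → m row 0 ≡ toℕ u → m col 0 ≡ toℕ v →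
        eval m guard ≡ guardValue ∣ X ∣ (lookup X u) (adj (graph T) u v) (lookup X v) (lookup O v)
      guard-eval u v (((( _ , _ , es) , _ , _ , _ , os) , mb , _) , _ , _ , _ , mc , xs) mo mr ml
        rewrite mo | mr | ml | mb | mc | es u v | os v | xs u | xs v = refl

      guard-value-extends : ∀ u v →
        let g = guardValue ∣ X ∣ (lookup X u) (adj (graph T) u v) (lookup X v) (lookup O v) in
        g ≢ 0 × Extends X O u v ⊎ g ≡ 0 × ¬ Extends X O u v
      guard-value-extends u v
        with guard-correct ∣ X ∣ (lookup X u) (adj (graph T) u v) (lookup X v) (lookup O v)
      ... | inj₁ (g≢0 , y , o , z) = inj₁ (g≢0 , outside⇒∉ y , outside⇒∉ o , from z)
        where
        outside⇒∉ : ∀ {S : Subset n} {x} → lookup S x ≡ false → x ∉ₛ S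
        outside⇒∉ eq x∈S with trans (sym ([]=⇒lookup x∈S)) eq
        ... | ()
        from : ∣ X ∣ ≡ 0 ⊎ lookup X u ≡ true × adj (graph T) u v ≡ true →
          ∣ X ∣ ≡ 0 ⊎ u ∈ₛ X × Adj (graph T) u v
        from (inj₁ eq)       = inj₁ eq
        from (inj₂ (ux , e)) = inj₂ (lookup⇒[]= u X ux , subst True (sym e) tt)
      ... | inj₂ (g≡0 , ¬open) = inj₂ (g≡0 , λ (v∉X , v∉O , z) →
              ¬open (∉⇒outside v∉X , ∉⇒outside v∉O , to z))
        where
        ∉⇒outside : ∀ {S : Subset n} {x} → x ∉ₛ S → lookup S x ≡ false
        ∉⇒outside {S} {x} x∉S with lookup S x in eq
        ... | false = refl
        ... | true  = contradiction (lookup⇒[]= x S eq) x∉S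
        T⇒true : ∀ {x} → True x → x ≡ true
        T⇒true {true} _ = refl
        to : ∣ X ∣ ≡ 0 ⊎ u ∈ₛ X × Adj (graph T) u v →
          ∣ X ∣ ≡ 0 ⊎ lookup X u ≡ true × adj (graph T) u v ≡ true
        to (inj₁ eq)       = inj₁ eq
        to (inj₂ (ux , e)) = inj₂ ([]=⇒lookup ux , T⇒true e)

      guard-extends : ∀ {p m} u v → Inv X p m → m off 0 ≡ toℕ u * n → m row 0 ≡ toℕ u → m col 0 ≡ toℕ v →
        eval m guard ≢ 0 × Extends X O u v ⊎ eval m guard ≡ 0 × ¬ Extends X O u v
      guard-extends {p} {m} u v inv mo mr ml =
        subst (λ g → g ≢ 0 × Extends X O u v ⊎ g ≡ 0 × ¬ Extends X O u v)
          (sym (guard-eval {p} {m} u v inv mo mr ml)) (guard-value-extends u v)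

      size : ∀ {p} m → Inv X p m → m order 0 ≡ n
      size _ ((((mn , _) , _) , _) , _) = mn

      -- The machine does not multiply, so the start of row `i` of the adjacency matrix is kept in
      -- `off` by repeated addition.
      Rows : ℕ → ℕ → Memory → Set
      Rows p i m = Inv X p m × m off 0 ≡ i * n × Found (λ u _ → toℕ u < i) m

      Scanned : Fin n → ℕ → Fin n → Fin n → Set
      Scanned u j u′ v = toℕ u′ < toℕ u ⊎ u′ ≡ u × toℕ v < j

      Cols : ℕ → Fin n → ℕ → Memory → Set
      Cols p u j m = Inv X p m × m off 0 ≡ toℕ u * n × m row 0 ≡ toℕ u × Found (Scanned u j) m

      first-col : ∀ {u} m → Found (λ u′ _ → toℕ u′ < toℕ u) m → Found (Scanned u 0) m
      first-col m (inj₁ hit)         = inj₁ hit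
      first-col m (inj₂ (eq , none)) = inj₂ (eq , λ { u′ v (inj₁ u′<u) → none u′ v u′<u })

      next-col : ∀ {u v} m → ¬ Extends X O u v →
        Found (Scanned u (toℕ v)) m → Found (Scanned u (suc (toℕ v))) m
      next-col m ¬ext (inj₁ hit)         = inj₁ hit
      next-col {u} {v} m ¬ext (inj₂ (eq , none)) = inj₂ (eq , λ
        { u′ v′ (inj₁ u′<u)          → none u′ v′ (inj₁ u′<u)
        ; u′ v′ (inj₂ (refl , v′≤v)) →
            [ (λ v′<v → none u′ v′ (inj₂ (refl , v′<v)))
            , (λ v′≡v → subst (λ z → ¬ Extends X O u z) (sym (toℕ-injective v′≡v)) ¬ext)
            ]′ (m<1+n⇒m<n∨m≡n v′≤v) })

      next-row : ∀ {u} m → Found (Scanned u n) m → Found (λ u′ _ → toℕ u′ < suc (toℕ u)) m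
      next-row m (inj₁ hit)         = inj₁ hit
      next-row m (inj₂ (eq , none)) = inj₂ (eq , λ u′ v u′≤u → none u′ v
        ([ inj₁ , (λ u′≡u → inj₂ (toℕ-injective u′≡u , toℕ<n v)) ]′ (m<1+n⇒m<n∨m≡n u′≤u)))

      last-row : ∀ m → Found (λ u _ → toℕ u < n) m →
        (∃₂ λ u v → m found 0 ≡ toℕ v × Extends X O u v) ⊎ m found 0 ≡ n × Closed X O
      last-row m (inj₁ hit)         = inj₁ hit
      last-row m (inj₂ (eq , none)) = inj₂ (eq , λ u v → none u v (toℕ<n u))

      test-runs : ∀ {p u m} (v : Fin n) → m col 0 ≡ toℕ v → Cols p u (toℕ v) m →
        ∃₂ λ m′ o → Runs test m m′ o testCost 0 × m′ col 0 ≡ toℕ v ×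
          (∀ x → Cols p u (suc (toℕ v)) (write m′ col 0 x)) × [] ≡ o ++ []
      test-runs {p} {u} {m} v ml (inv , mo , mr , fd)
        with guard-extends {p} {m} u v inv mo mr ml
      ... | inj₁ (g≢0 , ext) = write m found 0 (m col 0) , [] ,
            if-yes {e = guard} g≢0 assigns , ml ,
            (λ _ → inv , mo , mr , inj₁ (u , v , ml , ext)) , refl
      ... | inj₂ (g≡0 , ¬ext) = m , [] ,
            if-no {e = guard} g≡0 (relax {d = 4} (s≤s z≤n) skips) , ml ,
            (λ _ → inv , mo , mr , next-col m ¬ext fd) , refl

      scanRow-runs : ∀ {p m} (u : Fin n) → m row 0 ≡ toℕ u → Rows p (toℕ u) m →
        ∃₂ λ m′ o → Runs scanRow m m′ o scanRowCost 1 × m′ row 0 ≡ toℕ u ×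
          (∀ x → Rows p (suc (toℕ u)) (write m′ row 0 x)) × [] ≡ o ++ []
      scanRow-runs {p} {m} u mr (inv , mo , fd) =
        let m′ , r , inv′ , mo′ , mr′ , fd′ =
              for-runs col {test} {testCost} {0} (Cols p u) (λ _ → []) refl
                (λ {_} {m} (inv , _) → size {p} m inv)
                (λ {m} → test-runs {p} {u} {m})
                {m} (λ _ → inv , mo , mr , first-col m fd)
        in write m′ off 0 (m′ order 0 +ℕ m′ off 0) , [] , r ⟫ assigns , mr′ ,
           (λ _ → inv′ , cong₂ _+ℕ_ (size {p} m′ inv′) mo′ , next-row m′ fd′) , refl

      find-runs : ∀ {p m} → Inv X p m →
        ∃ λ m′ → Runs find m m′ [] findCost 2 × Inv X p m′ ×
          ((∃₂ λ u v → m′ found 0 ≡ toℕ v × Extends X O u v) ⊎ m′ found 0 ≡ n × Closed X O)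
      find-runs {p} {m} inv =
        let m′ , r , inv′ , _ , fd =
              for-runs row {scanRow} {scanRowCost} {1} (Rows p) (λ _ → []) refl
                (λ {_} {m} (inv , _) → size {p} m inv)
                (λ {m} → scanRow-runs {p} {m})
                {write (write m found 0 (m order 0)) off 0 0}
                (λ _ → inv , refl , inj₂ (size {p} m inv , λ _ _ ()))
        in m′ , assigns ⟫ assigns ⟫ r , inv′ , last-row m′ fd

    -- The variant `d` is the number of missing vertices while an extension is known, and 0 as soon
    -- as growth ends, be it by success or by getting stuck. Throughout, `p` remembers the first
    -- vertex added.
    Growing : ℕ → ℕ → Memory → Set
    Growing p d m = ∃ λ X → Inv X p m × InducesConnected (graph T) X × I ⊆ X × Disjoint X O ×
      ((0 < d × ∃₂ λ u v → m found 0 ≡ toℕ v × Extends X O u v × ∣ X ∣ +ℕ d ≡ k)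
      ⊎ d ≡ 0 × m found 0 ≡ n × (∣ X ∣ ≡ k ⊎ ∣ X ∣ < k × Closed X O))

    greedy-exit : ∀ {p} m → Growing p 0 m → eval m (var order ∸ var found) ≡ 0
    greedy-exit m (X , _ , _ , _ , _ , inj₁ (() , _))
    greedy-exit {p} m (X , inv , _ , _ , _ , inj₂ (_ , mf , _)) =
      trans (cong₂ _∸ℕ_ (size X {p} m inv) mf) (n∸n≡0 n)

    grow-runs : ∀ {p d m} → Growing p (suc d) m → eval m (var order ∸ var found) ≢ 0 ×
      (∃ λ d′ → ∃₂ λ m′ o → d′ ≤ d × Runs grow m m′ o growCost 2 × Growing p d′ m′ × [] ≡ o ++ [])
    grow-runs (_ , _ , _ , _ , _ , inj₂ (() , _))
    grow-runs {p} {d} {m}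
      (X , inv@(((sizes , state) , based) , insᶜ , outsᶜ , mp , mc , xs) , conn , I⊆X , X∥O ,
       inj₁ (_ , u , v , mf , ext@(v∉X , _) , ∣X∣+d≡k)) =
      subst₂ (λ x y → x ∸ℕ y ≢ 0) (sym (size X {p} m inv)) (sym mf) (m>n⇒m∸n≢0 (toℕ<n v)) ,
      continue d refl
      where
      X⁺ = insert X v

      m₁ : Memory
      m₁ = write (write m cur (m found 0) 1) card 0 (m card 0 +ℕ 1)

      ∣X⁺∣ : m card 0 +ℕ 1 ≡ ∣ X⁺ ∣
      ∣X⁺∣ = trans (+-comm (m card 0) 1) (trans (cong suc mc) (sym (∣insert∣ X v v∉X)))

      ∣X⁺∣+d≡k : ∣ X⁺ ∣ +ℕ d ≡ k
      ∣X⁺∣+d≡k = trans (cong (_+ℕ d) (∣insert∣ X v v∉X)) (trans (sym (+-suc ∣ X ∣ d)) ∣X∣+d≡k)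

      inv₁ : Inv X⁺ p m₁
      inv₁ = ((sizes , state) , based) , insᶜ , outsᶜ , mp , ∣X⁺∣ , block-insert (m cur) 0 X v mf xs

      conn₁ : InducesConnected (graph T) X⁺
      conn₁ = insert-connected ext conn

      I⊆X⁺ : I ⊆ X⁺
      I⊆X⁺ x∈I = ∈-insert⁺ X v (I⊆X x∈I)

      missing : m quota 0 ∸ℕ (m card 0 +ℕ 1) ≡ d
      missing = trans (cong₂ _∸ℕ_ (trans (proj₁ (proj₂ sizes)) (sym ∣X⁺∣+d≡k)) ∣X⁺∣) (m+n∸m≡n ∣ X⁺ ∣ d)

      continue : ∀ e → d ≡ e → ∃ λ d′ → ∃₂ λ m′ o →
        d′ ≤ d × Runs grow m m′ o growCost 2 × Growing p d′ m′ × [] ≡ o ++ []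
      continue zero d≡0 = 0 , write m₁ found 0 (m order 0) , [] , z≤n ,
        assigns ⟫ assigns ⟫
          if-no {e = var quota ∸ var card} (trans missing d≡0) (relax (m≤m+n 4 _) assigns) ,
        (X⁺ , inv₁ , conn₁ , I⊆X⁺ , insert-disjoint ext X∥O ,
          inj₂ (refl , size X {p} m inv ,
            inj₁ (trans (sym (trans (cong (∣ X⁺ ∣ +ℕ_) d≡0) (+-identityʳ _))) ∣X⁺∣+d≡k))) ,
        refl
      continue (suc e) d≡1+e = searched (find-runs X⁺ {p} {m₁} inv₁)
        where
        0<d : 0 < d
        0<d = subst (0 <_) (sym d≡1+e) (s≤s z≤n)

        runs : ∀ {m′} → Runs find m₁ m′ [] findCost 2 → Runs grow m m′ [] growCost 2
        runs r = assigns ⟫ assigns ⟫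
          if-yes {e = var quota ∸ var card} (λ eq → >⇒≢ 0<d (trans (sym missing) eq)) r

        searched : (∃ λ m′ → Runs find m₁ m′ [] findCost 2 × Inv X⁺ p m′ ×
            ((∃₂ λ u v → m′ found 0 ≡ toℕ v × Extends X⁺ O u v) ⊎ m′ found 0 ≡ n × Closed X⁺ O)) →
          ∃ λ d′ → ∃₂ λ m′ o → d′ ≤ d × Runs grow m m′ o growCost 2 × Growing p d′ m′ × [] ≡ o ++ []
        searched (m′ , r , inv′ , inj₁ (u′ , v′ , mf′ , ext′)) = d , m′ , [] , ≤-refl , runs r ,
          (X⁺ , inv′ , conn₁ , I⊆X⁺ , insert-disjoint ext X∥O ,
            inj₁ (0<d , u′ , v′ , mf′ , ext′ , ∣X⁺∣+d≡k)) , refl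
        searched (m′ , r , inv′ , inj₂ (mf′ , closed)) = 0 , m′ , [] , z≤n , runs r ,
          (X⁺ , inv′ , conn₁ , I⊆X⁺ , insert-disjoint ext X∥O ,
            inj₂ (refl , mf′ , inj₂ (subst (∣ X⁺ ∣ <_) ∣X⁺∣+d≡k (m<m+n ∣ X⁺ ∣ 0<d) , closed))) , refl

    greedy-runs : ∀ {p m} d → d ≤ n → Growing p d m →
      ∃ λ m′ → Runs greedy m m′ [] greedyCost 3 × Growing p 0 m′
    greedy-runs {p} {m} d = while-runs {var order ∸ var found} {grow} {growCost} {2}
      (Growing p) (λ _ → []) refl (λ {m} → greedy-exit {p} m) (λ {d} {m} → grow-runs {p} {d} {m}) {d} {m}

    Copying : ℕ → Memory → Set
    Copying j m = Based m × BlockUpTo j (m cur) 0 I × BlockUpTo j (m ins) c I × BlockUpTo j (m outs) c O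

    copyCell-runs : ∀ {m} (v : Fin n) → m idx 0 ≡ toℕ v → Copying (toℕ v) m →
      ∃₂ λ m′ o → Runs copyCell m m′ o cellCost 0 × m′ idx 0 ≡ toℕ v ×
        (∀ x → Copying (suc (toℕ v)) (write m′ idx 0 x)) × [] ≡ o ++ []
    copyCell-runs {m} v mi (((sizes , mt , mk , is , os) , mb , below) , xs , is′ , os′) =
      _ , _ , assigns ⟫ assigns ⟫ assigns , mi ,
      (λ _ →
        ((sizes , mt , mk , block-put-miss (m ins) b I high is , block-put-miss (m outs) b O high os) , mb , λ i i<b →
          let ii , oi , ki = below i i<b
              i< = >⇒≢ (<-≤-trans i<b (≤-trans (m≤m+n b n) high))
          in trans (put-miss (m ins) _ i<) ii , trans (put-miss (m outs) _ i<) oi , ki) ,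
        blockUpTo-put (m cur) 0 I v mi in-value xs ,
        blockUpTo-put (m ins) c I v target in-value is′ ,
        blockUpTo-put (m outs) c O v target out-value os′) ,
      refl
      where
      target : m top 0 +ℕ m idx 0 ≡ c +ℕ toℕ v
      target = cong₂ _+ℕ_ mt mi

      high : c ≤ m top 0 +ℕ m idx 0
      high = ≤-trans (m≤m+n c (toℕ v)) (≤-reflexive (sym target))

      in-value : m ins (m base 0 +ℕ m idx 0) ≡ bit (lookup I v)
      in-value = trans (cong (m ins) (cong₂ _+ℕ_ mb mi)) (is v)

      out-value : m outs (m base 0 +ℕ m idx 0) ≡ bit (lookup O v)
      out-value = trans (cong (m outs) (cong₂ _+ℕ_ mb mi)) (os v)

    copy-runs : ∀ {m} → Based m → ∃ λ m′ → Runs copy m m′ [] copyCost 1 × Copying n m′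
    copy-runs {m} based = for-runs idx {copyCell} {cellCost} {0} Copying (λ _ → []) refl
      (λ (((( mn , _) , _) , _) , _) → mn) (λ {m} → copyCell-runs {m})
      {m} (λ _ → based , (λ _ ()) , (λ _ ()) , (λ _ ()))

    Split : Fin n → Memory → Set
    Split v m = State c (insert I v) O m × m cards b ≡ ∣ I ∣ × Block (m ins) b I ×
      Block (m outs) b (insert O v) × Below b m₀ m

    branch-runs : ∀ {X m} v → v ∉ₛ I → Inv X (toℕ v) m →
      ∃ λ m′ → Runs branch m m′ [] branchCost 3 × Split v m′
    branch-runs {X} {m} v v∉I
      (((sizes , mt , mk , is , os) , mb , below) , is′ , os′ , mp , _ , _) =
      _ , assigns ⟫ assigns ⟫ assigns ⟫ assigns ,
      (sizes , cong₂ _+ℕ_ mt (proj₁ sizes) ,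
        trans (put-hit (m cards) (m cards (m base 0) +ℕ 1) mt)
          (trans (cong (_+ℕ 1) (trans (cong (m cards) mb) mk))
            (trans (+-comm ∣ I ∣ 1) (sym (∣insert∣ I v v∉I)))) ,
        block-insert (m ins) c I v in-cell is′ ,
        block-put-low (m outs) c O (subst (_< c) (sym out-cell) (+-monoʳ-< b (toℕ<n v))) os′) ,
      trans (put-miss (m cards) (m cards (m base 0) +ℕ 1) (>⇒≢ (subst (b <_) (sym mt) b<c))) mk ,
      block-put-miss (m ins) b I (subst (c ≤_) (sym in-cell) (m≤m+n c (toℕ v))) is ,
      block-insert (m outs) b O v out-cell os ,
      λ i i<b → let ii , oi , ki = below i i<b in
        trans (put-miss (m ins) 1 (>⇒≢ (<-≤-trans i<b
          (subst (b ≤_) (sym in-cell) (≤-trans (m≤m+n b n) (m≤m+n c (toℕ v))))))) ii ,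
        trans (put-miss (m outs) 1 (>⇒≢ (<-≤-trans i<b
          (subst (b ≤_) (sym out-cell) (m≤m+n b (toℕ v)))))) oi ,
        trans (put-miss (m cards) (m cards (m base 0) +ℕ 1) (>⇒≢ (<-trans i<b (subst (b <_) (sym mt) b<c)))) ki
      where
      b<c : b < c
      b<c = m<m+n b (>-nonZero⁻¹ n)

      in-cell : m top 0 +ℕ m pick 0 ≡ c +ℕ toℕ v
      in-cell = cong₂ _+ℕ_ mt mp

      out-cell : m base 0 +ℕ m pick 0 ≡ b +ℕ toℕ v
      out-cell = cong₂ _+ℕ_ mb mp

    Popped : Memory → Set
    Popped m = m top 0 ≡ b × Sizes m × Below b m₀ m

    -- The charging condition of a split: a solution pays for it, or the slack granted to an empty
    -- `I` does.
    Live : Set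
    Live = ∣ I ∣ ≡ 0 ⊎ ∃ (Compatible I O)

    Outcome : Memory → Set
    Outcome m = (Popped m × ∀ S → ¬ Compatible I O S)
      ⊎ ∃₂ λ u v → Extends I O u v × Live × Split v m

    pop-based : ∀ m → Based m → Popped (write m top 0 (m base 0))
    pop-based m ((sizes , _) , mb , below) = mb , sizes , below

    module _ (valid : Valid I O) where
      open Valid valid

      extend-runs : ∀ {p m} u v → Inv I p m → m found 0 ≡ toℕ v → Extends I O u v → ∣ I ∣ < k →
        ∃ λ m′ → Runs extend m m′ [] extendCost 3 × Outcome m′
      extend-runs {p} {m} u v inv@(based , is , os , _ , mc , xs) mf ext ∣I∣<k =
        let m₂ , r , grown = greedy-runs {toℕ v} {m₁} (k ∸ℕ ∣ I ∣) (≤-trans (m∸n≤m k ∣ I ∣) k≤n)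
              (I , inv₁ , linked , (λ x∈I → x∈I) , disjoint ,
                inj₁ (m<n⇒0<n∸m ∣I∣<k , u , v , mf , ext , m+[n∸m]≡n (<⇒≤ ∣I∣<k)))
            m₃ , r′ , out = decide grown
        in m₃ , assigns ⟫ r ⟫ r′ , out
        where
        m₁ : Memory
        m₁ = write m pick 0 (m found 0)

        inv₁ : Inv I (toℕ v) m₁
        inv₁ = based , is , os , mf , mc , xs

        decision : Program
        decision = if (lit 1 ∸ cards [ var base ]) + (lit 1 ∸ (var quota ∸ var card))
          then branch else′ set top (var base)

        -- Here `1 ∸ x` acts as negation and addition as disjunction: the value is nonzero exactly
        -- if `I` is empty or `X` has reached `k` elements.
        decision-eval : ∀ X m → Inv X (toℕ v) m →
          eval m ((lit 1 ∸ cards [ var base ]) + (lit 1 ∸ (var quota ∸ var card)))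
            ≡ (1 ∸ℕ ∣ I ∣) +ℕ (1 ∸ℕ (k ∸ℕ ∣ X ∣))
        decision-eval X m ((((_ , mq , _) , _ , mk , _) , mb , _) , _ , _ , _ , mc , _)
          rewrite mb | mk | mq | mc = refl

        branches : ∀ X m → Inv X (toℕ v) m → (1 ∸ℕ ∣ I ∣) +ℕ (1 ∸ℕ (k ∸ℕ ∣ X ∣)) ≢ 0 → Live →
          ∃ λ m′ → Runs decision m m′ [] (14 +ℕ branchCost) 3 × Outcome m′
        branches X m inv ≢0 live =
          let m′ , r , split = branch-runs {X} {m} v (proj₁ ext) inv
          in m′ , if-yes (λ eq → ≢0 (trans (sym (decision-eval X m inv)) eq)) r ,
             inj₂ (u , v , ext , live , split)

        decide : ∀ {m} → Growing (toℕ v) 0 m →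
          ∃ λ m′ → Runs decision m m′ [] (14 +ℕ branchCost) 3 × Outcome m′
        decide (_ , _ , _ , _ , _ , inj₁ (() , _))
        -- The greedy set is itself the solution that pays for the split.
        decide {m} (X , inv , conn , I⊆X , X∥O , inj₂ (_ , _ , inj₁ ∣X∣≡k)) =
          branches X m inv
            (λ eq → contradiction (trans (cong (1 ∸ℕ_) (sym k∸∣X∣≡0)) (m+n≡0⇒n≡0 (1 ∸ℕ ∣ I ∣) eq)) λ ())
            (inj₂ (X , (∣X∣≡k , conn) , I⊆X , X∥O))
          where
          k∸∣X∣≡0 : k ∸ℕ ∣ X ∣ ≡ 0
          k∸∣X∣≡0 = trans (cong (k ∸ℕ_) ∣X∣≡k) (n∸n≡0 k)
        decide {m} (X , inv , conn , I⊆X , X∥O , inj₂ (_ , _ , inj₂ (∣X∣<k , closed))) with ∣ I ∣ ≟ 0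
        ... | yes I≡∅ = branches X m inv
              (λ eq → contradiction (trans (cong (1 ∸ℕ_) (sym I≡∅)) (m+n≡0⇒m≡0 _ eq)) λ ())
              (inj₁ I≡∅)
        ... | no I≢∅ = _ ,
              if-no (trans (decision-eval X m inv)
                (cong₂ _+ℕ_ (m≤n⇒m∸n≡0 (n≢0⇒n>0 I≢∅)) (m≤n⇒m∸n≡0 (m<n⇒0<n∸m ∣X∣<k))))
                (relax (m≤m+n 4 _) assigns) ,
              inj₁ (pop-based m (proj₁ inv) ,
                closed⇒incompatible closed I⊆X (inj₂ (n≢0⇒n>0 I≢∅)) ∣X∣<k)

      expand-runs : ∀ {m} → Based m → ∣ I ∣ < k → ∃ λ m′ → Runs expand m m′ [] expandCost 3 × Outcome m′
      expand-runs {m} based ∣I∣<k =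
        let m₁ , r₁ , based₁@((_ , _ , mk , _) , mb , _) , xs , is , os = copy-runs {m} based
            m₂ , r₂ , inv₂ , fd = find-runs I {m₁ pick 0} {write m₁ card 0 (m₁ cards (m₁ base 0))}
              (based₁ , (λ v → is v (toℕ<n v)) , (λ v → os v (toℕ<n v)) , refl ,
                trans (cong (m₁ cards) mb) mk , (λ v → xs v (toℕ<n v)))
            m₃ , r₃ , out = react inv₂ fd
        in m₃ , raise (s≤s z≤n) r₁ ⟫ assigns ⟫ raise (s≤s (s≤s z≤n)) r₂ ⟫ r₃ , out
        where
        reaction : Program
        reaction = if (var order ∸ var found) then extend else′ set top (var base)

        seed : ∣ I ∣ ≡ 0 ⊎ 0 < ∣ I ∣
        seed with ∣ I ∣
        ... | zero  = inj₁ refl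
        ... | suc _ = inj₂ (s≤s z≤n)

        react : ∀ {p m} → Inv I p m →
          (∃₂ λ u v → m found 0 ≡ toℕ v × Extends I O u v) ⊎ m found 0 ≡ n × Closed I O →
          ∃ λ m′ → Runs reaction m m′ [] (6 +ℕ extendCost) 3 × Outcome m′
        react {p} {m} inv (inj₁ (u , v , mf , ext)) =
          let m′ , r , out = extend-runs {p} {m} u v inv mf ext ∣I∣<k
          in m′ , if-yes (subst₂ (λ x y → x ∸ℕ y ≢ 0) (sym (size I {p} m inv)) (sym mf)
                    (m>n⇒m∸n≢0 (toℕ<n v))) r , out
        -- Already `I` is closed, so it takes the place of `X`; if it is empty, every vertex has
        -- been excluded.
        react {p} {m} inv (inj₂ (mf , closed)) =
          _ , if-no (trans (cong₂ _∸ℕ_ (size I {p} m inv) mf) (n∸n≡0 n)) (relax (m≤m+n 4 _) assigns) ,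
          inj₁ (pop-based m (proj₁ inv) , closed⇒incompatible closed (λ x∈I → x∈I) seed ∣I∣<k)

      drop-toList : ∀ {m} (S : Subset m) i →
        drop (toℕ i) (toList S) ≡ lookup S i ∷ drop (suc (toℕ i)) (toList S)
      drop-toList (x ∷ S) zero    = refl
      drop-toList (x ∷ S) (suc i) = drop-toList S i

      drop-all-toList : ∀ {m} (S : Subset m) → drop m (toList S) ≡ []
      drop-all-toList []      = refl
      drop-all-toList (x ∷ S) = drop-all-toList S

      print-runs : ∀ {m} → Based m →
        ∃ λ m′ → Runs (for idx printCell) m m′ (map bit (toList I)) (forCost 7) 1 × Based m′
      print-runs {m} based = for-runs idx {printCell} {7} {0} (λ _ → Based)
        (λ j → map bit (drop j (toList I))) (cong (map bit) (drop-all-toList I))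
        (λ (((mn , _) , _) , _) → mn)
        (λ {m} v mi based@((_ , _ , _ , is , _) , mb , _) → m , _ , prints , mi , (λ _ → based) ,
          trans (cong (map bit) (drop-toList I v))
            (cong (_∷ map bit (drop (suc (toℕ v)) (toList I)))
              (sym (trans (cong (m ins) (cong₂ _+ℕ_ mb mi)) (is v)))))
        {m} (λ _ → based)

      body-runs : State b I O m₀ → ∃ λ m′ →
        (∃ λ Ss → Enumerates I O Ss × Popped m′ × Runs body m₀ m′ (output Ss) bodyCost 3)
        ⊎ ∃₂ λ u v → Extends I O u v × Live × Split v m′ × ∣ I ∣ < k × Runs body m₀ m′ [] bodyCost 3
      body-runs state@((mn , mq , _) , mt , mk , _) with ∣ I ∣ <? k
      ... | yes ∣I∣<k = conclude (expand-runs {m₁} based₁ ∣I∣<k)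
        where
        m₁ : Memory
        m₁ = write m₀ base 0 (m₀ top 0 ∸ℕ m₀ order 0)

        base≡b : m₀ top 0 ∸ℕ m₀ order 0 ≡ b
        base≡b = trans (cong₂ _∸ℕ_ mt mn) (m+n∸n≡m b n)

        based₁ : Based m₁
        based₁ = state , base≡b , λ _ _ → refl , refl , refl

        runs : ∀ {m′} → Runs expand m₁ m′ [] expandCost 3 → Runs body m₀ m′ [] bodyCost 3
        runs r = assigns ⟫ if-yes
          (subst₂ (λ x y → x ∸ℕ y ≢ 0) (sym mq) (sym (trans (cong (m₀ cards) base≡b) mk)) (m>n⇒m∸n≢0 ∣I∣<k))
          (relax (m≤m+n _ _) r)

        conclude : (∃ λ m′ → Runs expand m₁ m′ [] expandCost 3 × Outcome m′) → _
        conclude (m′ , r , inj₁ (popped , none)) = m′ , inj₁ ([] , enumerates-[] none , popped , runs r)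
        conclude (m′ , r , inj₂ (u , v , ext , live , split)) =
          m′ , inj₂ (u , v , ext , live , split , ∣I∣<k , runs r)
      ... | no ∣I∣≮k =
        let m₂ , r , based₂ = print-runs {write m₀ base 0 (m₀ top 0 ∸ℕ m₀ order 0)}
              (state , base≡b , λ _ _ → refl , refl , refl)
        in _ , inj₁ (I ∷ [] ,
             enumerates-self ((∣I∣≡k , linked) , (λ x∈I → x∈I) , disjoint) ,
             pop-based m₂ based₂ ,
             (assigns ⟫ if-no
               (trans (cong₂ _∸ℕ_ mq (trans (cong (m₀ cards) base≡b) (trans mk ∣I∣≡k))) (n∸n≡0 k))
               (relax (m≤n+m _ expandCost) (raise (s≤s z≤n) r ⟫ assigns))))
        where
        ∣I∣≡k : ∣ I ∣ ≡ k
        ∣I∣≡k = ≤-antisym small (≮⇒≥ ∣I∣≮k)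

        base≡b : m₀ top 0 ∸ℕ m₀ order 0 ≡ b
        base≡b = trans (cong₂ _∸ℕ_ mt mn) (m+n∸n≡m b n)

  -- Composing and counting rounds

  -- The big-step semantics has no judgement for a loop that is still running. A partial execution
  -- is therefore expressed by continuation: every complete run from `m′` becomes one from `m`, at
  -- an additional cost of at most `B`.
  Reaches : Memory → Memory → List ℕ → ℕ → Set
  Reaches m m′ o B = ∀ {m″ o′ t′} → mainLoop , m′ ⇓ m″ , o′ , t′ →
    ∃ λ t → t ≤ B +ℕ t′ × (mainLoop , m ⇓ m″ , o ++ o′ , t)

  roundCost : ℕ
  roundCost = (3 +ℕ bodyCost) * n ^ 3

  reaches-once : ∀ {m m′ o} → m top 0 ≢ 0 → Runs body m m′ o bodyCost 3 → Reaches m m′ o roundCost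
  reaches-once top≢0 (within {t} t≤ r) {t′ = t′} r′ = _ ,
    (begin
      3 +ℕ (t +ℕ t′)                             ≡⟨ +-assoc 3 t t′ ⟨
      3 +ℕ t +ℕ t′                               ≤⟨ +-monoˡ-≤ t′ (+-mono-≤ (constant 3 3) t≤) ⟩
      3 * n ^ 3 +ℕ bodyCost * n ^ 3 +ℕ t′        ≡⟨ cong (_+ℕ t′) (*-distribʳ-+ (n ^ 3) 3 bodyCost) ⟨
      roundCost +ℕ t′                            ∎) ,
    while-true top≢0 r r′
    where open ≤-Reasoning

  reaches-trans : ∀ {m m₁ m₂ o₁ o₂ B₁ B₂} →
    Reaches m m₁ o₁ B₁ → Reaches m₁ m₂ o₂ B₂ → Reaches m m₂ (o₁ ++ o₂) (B₁ +ℕ B₂)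
  reaches-trans {m} {o₁ = o₁} {o₂} {B₁} {B₂} reach₁ reach₂ {m″} {o′} {t′} r =
    let t₂ , t₂≤ , r₂ = reach₂ r
        t₁ , t₁≤ , r₁ = reach₁ r₂
    in t₁ ,
       ≤-trans t₁≤ (≤-trans (+-monoʳ-≤ B₁ t₂≤) (≤-reflexive (sym (+-assoc B₁ B₂ t′)))) ,
       subst (λ o → mainLoop , m ⇓ m″ , o , t₁) (sym (++-assoc o₁ o₂ o′)) r₁

  output-++ : ∀ (Ss Ss′ : List (Subset n)) → output (Ss ++ Ss′) ≡ output Ss ++ output Ss′
  output-++ = concatMap-++ _

  -- The states with nothing included yet are never discarded, so they may have no solution.
  slack : ℕ → ℕ
  slack zero    = 1
  slack (suc _) = 0

  -- A binary tree with s splits has 1 + 2s nodes. Each split has one of the `N` solutions below it,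
  -- slack included, and each of these lies below at most `f` splits, whence s ≤ `f * N`.
  rounds : ℕ → ℕ → ℕ
  rounds f N = 1 +ℕ 2 * (f * N)

  rounds-split : ∀ f N₁ N₂ → 1 ≤ N₁ +ℕ N₂ → 1 +ℕ (rounds f N₁ +ℕ rounds f N₂) ≤ rounds (suc f) (N₁ +ℕ N₂)
  rounds-split f N₁ N₂ 1≤N = begin
    1 +ℕ (rounds f N₁ +ℕ rounds f N₂)                   ≡⟨ lhs f N₁ N₂ ⟩
    2 * 1 +ℕ (1 +ℕ 2 * (f * (N₁ +ℕ N₂)))                ≤⟨ +-monoˡ-≤ _ (*-monoʳ-≤ 2 1≤N) ⟩
    2 * (N₁ +ℕ N₂) +ℕ (1 +ℕ 2 * (f * (N₁ +ℕ N₂)))       ≡⟨ rhs f (N₁ +ℕ N₂) ⟩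
    rounds (suc f) (N₁ +ℕ N₂)                           ∎
    where
    open ≤-Reasoning
    lhs : ∀ f N₁ N₂ → 1 +ℕ ((1 +ℕ 2 * (f * N₁)) +ℕ (1 +ℕ 2 * (f * N₂))) ≡ 2 * 1 +ℕ (1 +ℕ 2 * (f * (N₁ +ℕ N₂)))
    lhs = solve-∀
    rhs : ∀ f N → 2 * N +ℕ (1 +ℕ 2 * (f * N)) ≡ 1 +ℕ 2 * (N +ℕ f * N)
    rhs = solve-∀

  below-trans : ∀ {b c} m₁ m₂ m₃ → b ≤ c → Below b m₁ m₂ → Below c m₂ m₃ → Below b m₁ m₃
  below-trans m₁ m₂ m₃ b≤c below₁ below₂ i i<b =
    let i₁ , o₁ , k₁ = below₁ i i<b
        i₂ , o₂ , k₂ = below₂ i (<-≤-trans i<b b≤c)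
    in trans i₂ i₁ , trans o₂ o₁ , trans k₂ k₁

  valid-insert : ∀ {I O u v} → Valid I O → Extends I O u v → ∣ I ∣ < k → Valid (insert I v) O
  valid-insert {I} {O} {u} {v} valid ext ∣I∣<k = record
    { linked   = insert-connected ext (Valid.linked valid)
    ; disjoint = insert-disjoint ext (Valid.disjoint valid)
    ; small    = subst (_≤ k) (sym (∣insert∣ I v (proj₁ ext))) ∣I∣<k
    }

  valid-exclude : ∀ {I O u v} → Valid I O → Extends I O u v → Valid I (insert O v)
  valid-exclude {I} {O} {u} {v} valid ext = record
    { linked   = Valid.linked valid
    ; disjoint = λ x∈I x∈ →
        [ (λ { refl → proj₁ ext x∈I }) , Valid.disjoint valid x∈I ]′ (∈-insert⁻ O v x∈)
    ; small    = Valid.small valid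
    }

  record Searched (b : ℕ) (I O : Subset n) (f : ℕ) (m : Memory) : Set where
    field
      sets       : List (Subset n)
      enumerates : Enumerates I O sets
      final      : Memory
      sizes      : Sizes final
      below      : Below b m final
      popped     : final top 0 ≡ b
      reaches    : Reaches m final (output sets) (rounds f (length sets +ℕ slack ∣ I ∣) * roundCost)

  -- Induction on the number `f` of undecided vertices, which drops by one in both children.
  search : ∀ f {b I O} m → Valid I O → ∣ I ∣ +ℕ ∣ O ∣ +ℕ f ≡ n → State b I O m → Searched b I O f m
  search f {b} {I} {O} m valid ∣I∣+∣O∣+f≡n state@(_ , mt , _) = proceed f ∣I∣+∣O∣+f≡n (body-runs valid state)
    where
    open Step b I O m

    top≢0 : m top 0 ≢ 0
    top≢0 eq = >⇒≢ (<-≤-trans (>-nonZero⁻¹ n) (m≤n+m n b)) (trans (sym mt) eq)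

    proceed : ∀ f → ∣ I ∣ +ℕ ∣ O ∣ +ℕ f ≡ n → (∃ λ m′ →
      (∃ λ Ss → Enumerates I O Ss × Popped m′ × Runs body m m′ (output Ss) bodyCost 3)
      ⊎ ∃₂ λ u v → Extends I O u v × Live × Split v m′ × ∣ I ∣ < k × Runs body m m′ [] bodyCost 3) → Searched b I O f m
    proceed f _ (m′ , inj₁ (Ss , enum , (top≡b , sizes , below) , r)) = record
      { sets = Ss ; enumerates = enum ; final = m′ ; sizes = sizes ; below = below ; popped = top≡b
      ; reaches = λ r′ → let t , t≤ , r″ = reaches-once top≢0 r r′ in
          t , ≤-trans t≤ (+-monoˡ-≤ _ (m≤m+n roundCost _)) , r″
      }
    -- With no undecided vertex left, adding `v` to `I` would give two disjoint sets with more than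
    -- `n` elements together.
    proceed zero eq (m′ , inj₂ (u , v , ext@(v∉I , _) , _ , _ , ∣I∣<k , _)) =
      contradiction (disjoint⇒∣p∣+∣q∣≤n (insert I v) O (Valid.disjoint (valid-insert valid ext ∣I∣<k)))
        (<⇒≱ (≤-reflexive (trans (cong suc (trans (sym eq) (+-identityʳ _)))
          (cong (_+ℕ ∣ O ∣) (sym (∣insert∣ I v v∉I))))))
    proceed (suc f) eq (m′ , inj₂ (u , v , ext@(v∉I , v∉O , _) , live , (state₁ , mk , is , os , below) , ∣I∣<k , r)) =
      record
        { sets       = S₁.sets ++ S₂.sets
        ; enumerates = enum
        ; final      = S₂.final
        ; sizes      = S₂.sizes
        ; below      = below-trans m S₁.final S₂.final ≤-refl
                         (below-trans m m′ S₁.final (m≤m+n b n) below S₁.below) S₂.below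
        ; popped     = S₂.popped
        ; reaches    = λ {m″} {o′} {t′} r′ →
            let t , t≤ , r″ = reaches-trans {m₂ = S₂.final} (reaches-once top≢0 r)
                                (reaches-trans {m₂ = S₂.final} S₁.reaches S₂.reaches) r′
            in t , ≤-trans t≤ (+-monoˡ-≤ t′ bound) ,
               subst (λ o → mainLoop , m ⇓ m″ , o ++ o′ , t) (sym (output-++ S₁.sets S₂.sets)) r″
        }
      where
      count₁ : ∣ insert I v ∣ +ℕ ∣ O ∣ +ℕ f ≡ n
      count₁ rewrite ∣insert∣ I v v∉I = trans (sym (+-suc (∣ I ∣ +ℕ ∣ O ∣) f)) eq

      count₂ : ∣ I ∣ +ℕ ∣ insert O v ∣ +ℕ f ≡ n
      count₂ rewrite ∣insert∣ O v v∉O | +-suc ∣ I ∣ ∣ O ∣ = trans (sym (+-suc (∣ I ∣ +ℕ ∣ O ∣) f)) eq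

      module S₁ = Searched (search f {b +ℕ n} {insert I v} {O} m′ (valid-insert valid ext ∣I∣<k) count₁ state₁)

      -- The second child lives in the edited block of its parent. The first child was searched from
      -- `b + n` upwards, so that block is intact.
      state₂ : State b I (insert O v) S₁.final
      state₂ =
        S₁.sizes , S₁.popped ,
        trans (proj₂ (proj₂ (S₁.below b (m<m+n b (>-nonZero⁻¹ n))))) mk ,
        (λ i → trans (proj₁ (S₁.below _ (+-monoʳ-< b (toℕ<n i)))) (is i)) ,
        (λ i → trans (proj₁ (proj₂ (S₁.below _ (+-monoʳ-< b (toℕ<n i))))) (os i))

      module S₂ = Searched (search f {b} {I} {insert O v} S₁.final (valid-exclude valid ext) count₂ state₂)

      enum : Enumerates I O (S₁.sets ++ S₂.sets)
      enum = enumerates-++ v S₁.enumerates S₂.enumerates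

      N : ℕ
      N = length (S₁.sets ++ S₂.sets) +ℕ slack ∣ I ∣

      -- The slack is passed on to the excluding child only: `insert I v` is nonempty and has none.
      -- Hence it is counted once in the whole search.
      N≡ : (length S₁.sets +ℕ slack ∣ insert I v ∣) +ℕ (length S₂.sets +ℕ slack ∣ I ∣) ≡ N
      N≡ = begin
        L₁ +ℕ slack ∣ insert I v ∣ +ℕ (L₂ +ℕ slack ∣ I ∣)
          ≡⟨ cong (λ s → L₁ +ℕ slack s +ℕ (L₂ +ℕ slack ∣ I ∣)) (∣insert∣ I v v∉I) ⟩
        L₁ +ℕ 0 +ℕ (L₂ +ℕ slack ∣ I ∣)    ≡⟨ cong (_+ℕ (L₂ +ℕ slack ∣ I ∣)) (+-identityʳ L₁) ⟩
        L₁ +ℕ (L₂ +ℕ slack ∣ I ∣)         ≡⟨ +-assoc L₁ L₂ (slack ∣ I ∣) ⟨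
        L₁ +ℕ L₂ +ℕ slack ∣ I ∣           ≡⟨ cong (_+ℕ slack ∣ I ∣) (length-++ S₁.sets) ⟨
        N                                 ∎
        where
        open ≡-Reasoning
        L₁ L₂ : ℕ
        L₁ = length S₁.sets
        L₂ = length S₂.sets

      1≤N : 1 ≤ N
      1≤N = [ (λ I≡∅ → ≤-trans (≤-reflexive (cong slack (sym I≡∅))) (m≤n+m _ _))
            , (λ (S , compatible) → ≤-trans (∈-length (Equivalence.from (Enumerates.members enum S) compatible))
                (m≤m+n _ _)) ]′ live

      bound : roundCost +ℕ (rounds f (length S₁.sets +ℕ slack ∣ insert I v ∣) * roundCost
          +ℕ rounds f (length S₂.sets +ℕ slack ∣ I ∣) * roundCost) ≤ rounds (suc f) N * roundCost
      bound = begin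
        roundCost +ℕ (rounds f N₁ * roundCost +ℕ rounds f N₂ * roundCost)
          ≡⟨ cong (roundCost +ℕ_) (*-distribʳ-+ roundCost (rounds f N₁) (rounds f N₂)) ⟨
        (1 +ℕ (rounds f N₁ +ℕ rounds f N₂)) * roundCost
          ≤⟨ *-monoˡ-≤ roundCost (rounds-split f N₁ N₂ (subst (1 ≤_) (sym N≡) 1≤N)) ⟩
        rounds (suc f) (N₁ +ℕ N₂) * roundCost
          ≡⟨ cong (λ N → rounds (suc f) N * roundCost) N≡ ⟩
        rounds (suc f) N * roundCost ∎
        where
        open ≤-Reasoning
        N₁ N₂ : ℕ
        N₁ = length S₁.sets +ℕ slack ∣ insert I v ∣
        N₂ = length S₂.sets +ℕ slack ∣ I ∣

-- Reading the adjacency matrix from the input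

nth : List ℕ → ℕ → ℕ
nth xs i = fromMaybe 0 (head (drop i xs))

nth-[] : ∀ i → nth [] i ≡ 0
nth-[] zero    = refl
nth-[] (suc i) = refl

nth-tabulate-++ : ∀ {w} (g : Fin w → ℕ) zs v → nth (tabulate g ++ zs) (toℕ v) ≡ g v
nth-tabulate-++ g zs zero    = refl
nth-tabulate-++ g zs (suc v) = nth-tabulate-++ (g ∘ suc) zs v

nth-tabulate-++ʳ : ∀ {w} (g : Fin w → ℕ) zs i → nth (tabulate g ++ zs) (w +ℕ i) ≡ nth zs i
nth-tabulate-++ʳ {zero}  g zs i = refl
nth-tabulate-++ʳ {suc w} g zs i = nth-tabulate-++ʳ (g ∘ suc) zs i

-- Stated for any `h`, because dropping the first row of the matrix replaces `h` by `h ∘ suc`.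
nth-cartesianProductWith : ∀ {A : Set} {r w} (f : A → Fin w → ℕ) (h : Fin r → A) u v →
  nth (cartesianProductWith f (tabulate h) (allFin w)) (toℕ u * w +ℕ toℕ v) ≡ f (h u) v
nth-cartesianProductWith {w = w} f h zero v
  rewrite map-tabulate {n = w} (λ z → z) (f (h zero)) = nth-tabulate-++ (f (h zero)) _ v
nth-cartesianProductWith {w = w} f h (suc u) v
  rewrite map-tabulate {n = w} (λ z → z) (f (h zero)) | +-assoc w (toℕ u * w) (toℕ v) =
  trans (nth-tabulate-++ʳ (f (h zero)) _ (toℕ u * w +ℕ toℕ v))
    (nth-cartesianProductWith f (h ∘ suc) u v)

-- The complete algorithm and its running time

algorithm : Program
algorithm = set top (var order) ⨾ mainLoop

-- The 7 is made up of 4 steps for the initial assignment and 3 for the last test of the loop. The 5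
-- comes from 1 + 2w(N + 1) ≤ 5wN, where the additional solution is the slack of the empty set.
totalCost : ℕ
totalCost = 7 +ℕ 5 * (3 +ℕ bodyCost)

-- There is at least one subtree, so the rounds spent on states without a solution are absorbed.
total-bound : ∀ N w r → 1 ≤ N → 1 ≤ w →
  4 +ℕ ((1 +ℕ 2 * (w * (N +ℕ 1))) * (r * w ^ 3) +ℕ 3) ≤ (7 +ℕ 5 * r) * (N * w ^ 5)
total-bound N@(suc N′) w@(suc w′) r 1≤N 1≤w = begin
  4 +ℕ ((1 +ℕ 2 * (w * (N +ℕ 1))) * (r * w ^ 3) +ℕ 3)
    ≡⟨ lhs N w (r * w ^ 3) ⟩
  7 +ℕ (1 +ℕ 2 * (w * N) +ℕ 2 * (w * 1)) * (r * w ^ 3)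
    ≤⟨ +-monoʳ-≤ 7 (*-monoˡ-≤ (r * w ^ 3)
         (+-mono-≤ (+-monoˡ-≤ (2 * (w * N)) (*-mono-≤ 1≤w 1≤N)) (*-monoʳ-≤ 2 (*-monoʳ-≤ w 1≤N)))) ⟩
  7 +ℕ (w * N +ℕ 2 * (w * N) +ℕ 2 * (w * N)) * (r * w ^ 3)
    ≡⟨ cong (7 +ℕ_) (rhs N w r (w ^ 3)) ⟩
  7 +ℕ 5 * r * (N * w ^ 4)
    ≤⟨ +-mono-≤ (*-monoʳ-≤ 7 (*-mono-≤ 1≤N (m^n>0 w 5)))
         (*-monoʳ-≤ (5 * r) (*-monoʳ-≤ N (^-monoʳ-≤ w (n≤1+n 4)))) ⟩
  7 * (N * w ^ 5) +ℕ 5 * r * (N * w ^ 5)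
    ≡⟨ *-distribʳ-+ (N * w ^ 5) 7 (5 * r) ⟨
  (7 +ℕ 5 * r) * (N * w ^ 5) ∎
  where
  open ≤-Reasoning
  lhs : ∀ N w x → 4 +ℕ ((1 +ℕ 2 * (w * (N +ℕ 1))) * x +ℕ 3) ≡ 7 +ℕ (1 +ℕ 2 * (w * N) +ℕ 2 * (w * 1)) * x
  lhs = solve-∀
  rhs : ∀ N w r x → (w * N +ℕ 2 * (w * N) +ℕ 2 * (w * N)) * (r * x) ≡ 5 * r * (N * (w * x))
  rhs = solve-∀

module Main {w : ℕ} .{{_ : NonZero w}} (T : Tree w) (k : ℕ) (k≤w : k ≤ w) where

  open Correctness T k k≤w
  open Search T k

  start : Memory
  start = write (input T k) top 0 w

  empty-block : ∀ i → nth [] (toℕ i) ≡ bit (lookup (⊥ {w}) i)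
  empty-block i = trans (nth-[] (toℕ i)) (cong bit (sym (lookup-replicate i outside)))

  start-state : State 0 ⊥ ⊥ start
  start-state = (refl , refl , nth-cartesianProductWith (λ u v → bit (adj (graph T) u v)) (λ u → u)) ,
    refl , sym (∣⊥∣≡0 w) , empty-block , empty-block

  start-valid : Valid ⊥ ⊥
  start-valid = record
    { linked   = λ _ _ u∈⊥ → contradiction u∈⊥ ∉⊥
    ; disjoint = λ x∈⊥ → contradiction x∈⊥ ∉⊥
    ; small    = subst (_≤ k) (sym (∣⊥∣≡0 w)) z≤n
    }

  all-free : ∣ ⊥ {w} ∣ +ℕ ∣ ⊥ {w} ∣ +ℕ w ≡ w
  all-free rewrite ∣⊥∣≡0 w = refl

  open Searched (search w {0} {⊥} {⊥} start start-valid all-free start-state)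

  compatible : ∀ {S} → IsSubtree T k S → Compatible ⊥ ⊥ S
  compatible sub = sub , (λ x∈⊥ → contradiction x∈⊥ ∉⊥) , (λ _ → ∉⊥)

  enumeration : IsEnumeration T k sets
  enumeration = record
    { unique  = Enumerates.unique enumerates
    ; members = λ S → let open Equivalence (Enumerates.members enumerates S) in
        mk⇔ (proj₁ ∘ to) (from ∘ compatible)
    }

  nonempty : 1 ≤ length sets
  nonempty = let S , sub = connected-subset (Tree.connected T) k k≤w in
    ∈-length (Equivalence.from (IsEnumeration.members enumeration S) sub)

  result : ∃[ Ss ] ∃[ m ] ∃[ t ]
    (IsEnumeration T k Ss × (algorithm , input T k ⇓ m , output Ss , t) × t ≤ totalCost * (length Ss * w ^ 5))
  result =
    -- The root block starts at 0, so `popped` says that the stack is empty; the exit of the loop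
    -- then serves as the continuation.
    let t , t≤ , r = reaches (while-false {p = body} popped)
    in sets , final , 4 +ℕ t , enumeration ,
       subst (λ o → algorithm , input T k ⇓ final , o , 4 +ℕ t) (++-identityʳ (output sets)) (seq assign r) ,
       ≤-trans (+-monoʳ-≤ 4 (subst (λ s → t ≤ rounds w (length sets +ℕ slack s) * roundCost +ℕ 3) (∣⊥∣≡0 w) t≤))
         (total-bound (length sets) w (3 +ℕ bodyCost) nonempty (>-nonZero⁻¹ w))

corollary4 : Σ[ 𝒜 ∈ Program ] Σ[ C ∈ ℕ ]
    ((w : ℕ) (T : Tree w) (k : ℕ) → 1 ≤ k → k ≤ w →
    ∃[ Ss ] ∃[ m ] ∃[ t ]
    (IsEnumeration T k Ss
    × (𝒜 , input T k ⇓ m , output Ss , t)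
    × t ≤ C * (length Ss * w ^ 5)))
corollary4 = algorithm , totalCost , λ w T k 1≤k k≤w →
  Main.result {{>-nonZero (≤-trans 1≤k k≤w)}} T k k≤w
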